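{- There is a bounded function $e_9$ on the positive integers such that $M(9, n) = \lfloor n/17\rfloor + e_9(n)$ for all positive integers $n$; equivalently, $M(9,n)-\lfloor n/17\rfloor$ is bounded as $n$ ranges over the positive integers.
   Context: The $T$-tetromino is the polyomino formed by four unit squares: three in a row together with a fourth square attached to the middle square of that row. A tiling of an $m\times n$ rectangle (of unit cells) by $T$-tetrominos and monominos is a partition of its cells into copies of the $T$-tetromino (in any rotation or reflection, aligned with the grid) and single cells (monominos). The gap number $M(m,n)$ is the least number of monominos occurring in such a tiling of the $m\times n$ rectangle. -}

module Defs where

open import Data.Nat using (ℕ; zero; suc; _+_; _*_; _∸_; _<_; _≤_)
open import Data.Product using (_×_; _,_; Σ; ∃)
open import Data.List using (List; []; _∷_; length; concatMap)
open import Data.List.Membership.Propositional using (_∈_)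
open import Data.List.Relation.Unary.All using (All)
open import Data.List.Relation.Unary.Unique.Propositional using (Unique)
open import Relation.Binary.PropositionalEquality using (_≡_)

-- A cell of the grid: (row , column), 0-indexed.
Cell : Set
Cell = ℕ × ℕ

-- The four orientations of the T-tetromino (the T-tetromino is
-- mirror-symmetric, so reflections give nothing new beyond rotations).
data Orientation : Set where
  stemDown stemUp stemRight stemLeft : Orientation

-- A placed T-tetromino: orientation plus the top-left corner (r , c)
-- of its bounding box (3 wide × 2 high, or 2 wide × 3 high).
record Tetro : Set where
  constructor tetro
  field
    orient : Orientation
    row    : ℕ
    col    : ℕ

cells : Tetro → List Cell
cells (tetro stemDown r c) =
  (r , c) ∷ (r , suc c) ∷ (r , suc (suc c)) ∷ (suc r , suc c) ∷ []
cells (tetro stemUp r c) =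
  (suc r , c) ∷ (suc r , suc c) ∷ (suc r , suc (suc c)) ∷ (r , suc c) ∷ []
cells (tetro stemRight r c) =
  (r , c) ∷ (suc r , c) ∷ (suc (suc r) , c) ∷ (suc r , suc c) ∷ []
cells (tetro stemLeft r c) =
  (r , suc c) ∷ (suc r , suc c) ∷ (suc (suc r) , suc c) ∷ (suc r , c) ∷ []

InRect : ℕ → ℕ → Cell → Set
InRect m n (r , c) = r < m × c < n

-- A tiling of the m × n rectangle by T-tetrominos and monominos is
-- determined by its list of T-tetrominos: they must lie inside the
-- rectangle and be pairwise disjoint (all their cells distinct); every
-- remaining cell is a monomino.
IsTTiling : ℕ → ℕ → List Tetro → Set
IsTTiling m n ts =
  All (λ t → All (InRect m n) (cells t)) ts × Unique (concatMap cells ts)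

monominos : ℕ → ℕ → List Tetro → ℕ
monominos m n ts = m * n ∸ 4 * length ts

Attainable : ℕ → ℕ → ℕ → Set
Attainable m n k = Σ (List Tetro) λ ts → IsTTiling m n ts × monominos m n ts ≡ k

IsGapNumber : ℕ → ℕ → ℕ → Set
IsGapNumber m n k = Attainable m n k × (∀ k' → Attainable m n k' → k ≤ k')

{-# OPTIONS --safe #-}
module Submission where

-- Number the cells of the 9 × n strip column by column and place the
-- tetrominoes of a tiling in the order of their least cells. What matters for
-- the sequel is only the profile of later cells already covered. A potential S
-- on profiles such that filling one column with g tetrominoes always lowers S
-- by at least 17 g - 38 yields 17 L ≤ 38 n + S(empty) for every tiling with L
-- tetrominoes, so that the number 9 n - 4 L of monominoes is at least
-- n / 17 - O(1). Such a potential is given explicitly and checked by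
-- evaluation. Conversely, there is a periodic pattern with 38 tetrominoes and
-- one monomino per 17 columns.

open import Defs
open import Data.Nat using (ℕ; _/_; _≤_; _>_)
open import Data.Integer using (ℤ; +_; _+_; ∣_∣)
open import Data.Product using (Σ; _×_)
open import Relation.Binary.PropositionalEquality using (_≡_)

open import Data.Nat as ℕ using (zero; suc; pred; _∸_; _<_; _≤ᵇ_; _<ᵇ_; _%_; z≤n; s≤s)
open import Data.Nat.DivMod using (m≡m%n+[m/n]*n; m%n<n; m/n*n≤m; [m+kn]%n≡m%n; m<n⇒m%n≡m)
import Data.Nat.Properties as ℕ
open import Data.Nat.Tactic.RingSolver using (solve-∀)
open import Data.Integer using (_⊖_)
import Data.Integer.Properties as ℤ
open import Data.Product using (_,_; proj₁; proj₂; ∃; map₂)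
import Data.Product.Properties as Product
open import Data.Sum using (_⊎_; inj₁; inj₂; [_,_]′)
open import Data.Bool using (Bool; true; false; _∧_; _∨_; not; if_then_else_)
open import Data.Bool.Properties using (∧-conicalˡ; ∧-conicalʳ; ¬-not; T-≡)
open import Data.Bool.ListAction using (any)
open import Data.List using (List; []; _∷_; _++_; map; foldr; length; concatMap; upTo; filter; cartesianProduct; cartesianProductWith)
open import Data.List.Properties using (concatMap-++; concatMap-cong; concatMap-map; map-concatMap; length-map; ++-assoc)
open import Data.List.Extrema ℕ.≤-totalOrder using (argmin; argmin-all; f[argmin]≤f[xs])
open import Data.List.Membership.Propositional using (_∈_; find; lose)
open import Data.List.Membership.Propositional.Properties
  using (∈-map⁺; ∈-map⁻; ∈-∃++; ∈-concatMap⁺; ∈-upTo⁺; ∈-filter⁺; ∈-cartesianProduct⁺; ∈-cartesianProductWith⁺)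
open import Data.List.Membership.DecPropositional (Product.≡-dec ℕ._≟_ ℕ._≟_) using (_∈?_)
open import Data.List.Relation.Unary.All as All using (All; []; _∷_)
import Data.List.Relation.Unary.All.Properties as All
open import Data.List.Relation.Unary.Any as Any using (here; there)
open import Data.List.Relation.Unary.AllPairs using (AllPairs; []; _∷_)
open import Data.List.Relation.Unary.Unique.Propositional using (Unique)
import Data.List.Relation.Unary.Unique.Propositional.Properties as Unique
open import Data.List.Relation.Unary.Unique.DecPropositional (Product.≡-dec ℕ._≟_ ℕ._≟_) using (unique?)
open import Data.List.Relation.Binary.Disjoint.Propositional using (Disjoint)
open import Data.List.Relation.Binary.Permutation.Propositional using (_↭_; ↭⇒↭ₛ)
open import Data.List.Relation.Binary.Permutation.Propositional.Properties using (All-resp-↭; ↭-length; shift)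
import Data.List.Relation.Binary.Permutation.Setoid.Properties as Permutation
open import Algebra.Properties.CommutativeSemigroup ℕ.+-commutativeSemigroup using (x∙yz≈y∙xz)
open import Function using (_∘_; _∘′_; Equivalence)
open import Relation.Binary.PropositionalEquality
  using (_≢_; refl; sym; trans; cong; cong₂; subst; resp₂; setoid; module ≡-Reasoning)
open import Relation.Nullary using (yes; no; contradiction)
open import Relation.Nullary.Decidable using (_×-dec_; _⊎-dec_; from-yes)
open import Relation.Unary using (Decidable)

-- The constants rest on 17 * 9 = 4 * 38 + 1: at a density of 38 tetrominoes per 17 columns exactly
-- one cell in 17 columns stays uncovered. Potential and pattern certify each other. Weight the
-- passage through a column with g tetrominoes by 17 g - 38: the potential excludes cycles of
-- profiles of positive weight, and the pattern is a cycle of weight zero, so neither bound can be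
-- improved. The obstacle is the number of profiles. An overhang reaches 18 cells past the top of a
-- column, too many combinations to list one by one. But a covered cell only restricts later
-- placements, so a bound proved after forgetting some covered cells holds for the full profile too.
-- Hence the potential can be a decision tree in which each leaf needs a single check, made for the
-- entries found true. The check ignores the right end of the strip; this only admits more fillings,
-- which is harmless when bounding tetrominoes from above. The error term must be a function of `n`
-- fixed before any gap number is given. It is therefore built from a minimum that a finite search
-- computes.

-- Disjointness from duplicate-free concatenations.

module _ {A : Set} where

  Unique-++⁻ʳ : ∀ (xs : List A) {ys} → Unique (xs ++ ys) → Unique ys
  Unique-++⁻ʳ []       u       = u
  Unique-++⁻ʳ (x ∷ xs) (_ ∷ u) = Unique-++⁻ʳ xs u

  Unique-++⁻-Disjoint : ∀ (xs : List A) {ys} → Unique (xs ++ ys) → Disjoint xs ys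
  Unique-++⁻-Disjoint (x ∷ xs) (x∉ ∷ u) (here refl , v∈ys) = All.lookup (All.++⁻ʳ xs x∉) v∈ys refl
  Unique-++⁻-Disjoint (x ∷ xs) (_ ∷ u)  (there v∈xs , v∈ys) = Unique-++⁻-Disjoint xs u (v∈xs , v∈ys)

  module _ {B : Set} {f : B → List A} where

    Unique-concatMap⁻ : ∀ ts → Unique (concatMap f ts) → AllPairs (λ t u → Disjoint (f t) (f u)) ts
    Unique-concatMap⁻ []       u = []
    Unique-concatMap⁻ (t ∷ ts) u =
      All.tabulate (λ u∈ts (x∈t , x∈u) →
        Unique-++⁻-Disjoint (f t) u (x∈t , ∈-concatMap⁺ f (lose u∈ts x∈u)))
      ∷ Unique-concatMap⁻ ts (Unique-++⁻ʳ (f t) u)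

-- The column-by-column numbering and the shapes of tetrominoes in it.

pos : Cell → ℕ
pos (r , c) = r ℕ.+ c ℕ.* 9

-- Division by 9 with remainder: for rows below 9 the row is the remainder of the number and the
-- column its quotient.
pos-injective : ∀ x y → proj₁ x < 9 → proj₁ y < 9 → pos x ≡ pos y → x ≡ y
pos-injective (r , c) (r′ , c′) r<9 r′<9 eq = cong₂ _,_ r≡r′ c≡c′
  where
  open ≡-Reasoning
  r≡r′ : r ≡ r′
  r≡r′ = begin
    r                   ≡⟨ m<n⇒m%n≡m r<9 ⟨
    r % 9               ≡⟨ [m+kn]%n≡m%n r c 9 ⟨
    pos (r , c) % 9     ≡⟨ cong (_% 9) eq ⟩
    pos (r′ , c′) % 9   ≡⟨ [m+kn]%n≡m%n r′ c′ 9 ⟩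
    r′ % 9              ≡⟨ m<n⇒m%n≡m r′<9 ⟩
    r′                  ∎
  c≡c′ : c ≡ c′
  c≡c′ = ℕ.*-cancelʳ-≡ c c′ 9
    (ℕ.+-cancelˡ-≡ r (c ℕ.* 9) (c′ ℕ.* 9) (trans eq (cong (ℕ._+ c′ ℕ.* 9) (sym r≡r′))))

-- The cell of least number.
anchor : Tetro → Cell
anchor (tetro stemDown  r c) = r , c
anchor (tetro stemUp    r c) = suc r , c
anchor (tetro stemRight r c) = r , c
anchor (tetro stemLeft  r c) = suc r , c

-- Cell numbers relative to the anchor: 9 is one column to the right, while 8 and 10 are the
-- diagonal neighbours there. The order is that of `cells`, so that `map-pos-cells` can be an
-- equality of lists. The largest offset, 18, limits how far a profile reaches.
offsets : Orientation → List ℕ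
offsets stemDown  = 0 ∷ 9 ∷ 18 ∷ 10 ∷ []
offsets stemUp    = 0 ∷ 9 ∷ 18 ∷ 8 ∷ []
offsets stemRight = 0 ∷ 1 ∷ 2 ∷ 10 ∷ []
offsets stemLeft  = 8 ∷ 9 ∷ 10 ∷ 0 ∷ []

map-pos-cells : ∀ t → map pos (cells t) ≡ map (ℕ._+ pos (anchor t)) (offsets (Tetro.orient t))
map-pos-cells (tetro stemDown r c)
  rewrite x∙yz≈y∙xz r 9 (c ℕ.* 9) | x∙yz≈y∙xz r 18 (c ℕ.* 9) = refl
map-pos-cells (tetro stemUp r c)
  rewrite x∙yz≈y∙xz r 9 (c ℕ.* 9) | x∙yz≈y∙xz r 18 (c ℕ.* 9) = refl
map-pos-cells (tetro stemRight r c)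
  rewrite x∙yz≈y∙xz r 9 (c ℕ.* 9) = refl
map-pos-cells (tetro stemLeft r c)
  rewrite x∙yz≈y∙xz r 9 (c ℕ.* 9) = refl

offset-cell : ∀ t {o} → o ∈ offsets (Tetro.orient t) → ∃ λ x → x ∈ cells t × o ℕ.+ pos (anchor t) ≡ pos x
offset-cell t {o} o∈ = ∈-map⁻ pos (subst (o ℕ.+ pos (anchor t) ∈_) (sym (map-pos-cells t)) (∈-map⁺ (ℕ._+ pos (anchor t)) o∈))

anchor∈cells : ∀ t → anchor t ∈ cells t
anchor∈cells (tetro stemDown  r c) = here refl
anchor∈cells (tetro stemUp    r c) = here refl
anchor∈cells (tetro stemRight r c) = here refl
anchor∈cells (tetro stemLeft  r c) = there (there (there (here refl)))

-- The argument is the row of the anchor, not that of the bounding box. The conditions prevent an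
-- offset from wrapping around the top or bottom of a column. For `stemUp` the anchor lies in the
-- lowest row of the tetromino, so only the row above it is in question.
allowed : Orientation → ℕ → Bool
allowed stemDown  r = r <ᵇ 8
allowed stemUp    r = 0 <ᵇ r
allowed stemRight r = r <ᵇ 7
allowed stemLeft  r = (0 <ᵇ r) ∧ (r <ᵇ 8)

<⇒<ᵇ≡true : ∀ {m n} → m < n → (m <ᵇ n) ≡ true
<⇒<ᵇ≡true = Equivalence.to T-≡ ∘ ℕ.<⇒<ᵇ

InRect⇒allowed : ∀ {n} t → All (InRect 9 n) (cells t) → allowed (Tetro.orient t) (proj₁ (anchor t)) ≡ true
InRect⇒allowed (tetro stemDown  r c) (_ ∷ _ ∷ _ ∷ (r<9 , _) ∷ []) = <⇒<ᵇ≡true (ℕ.s≤s⁻¹ r<9)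
InRect⇒allowed (tetro stemUp    r c) _                            = refl
InRect⇒allowed (tetro stemRight r c) (_ ∷ _ ∷ (r<9 , _) ∷ _)      = <⇒<ᵇ≡true (ℕ.s≤s⁻¹ (ℕ.s≤s⁻¹ r<9))
InRect⇒allowed (tetro stemLeft  r c) (_ ∷ _ ∷ (r<9 , _) ∷ _)      = <⇒<ᵇ≡true (ℕ.s≤s⁻¹ r<9)

-- Profiles, potentials and the check of one column.

-- Entry i of a profile at position p tells whether the cell number i + p is
-- known to be covered by a tetromino anchored before p.
Profile : Set
Profile = List Bool

-- The default `false` past the end means that nothing is known there: `[]` is the profile without
-- information, and `set` lengthens a list when required.
bit : Profile → ℕ → Bool
bit []      i       = false
bit (b ∷ m) zero    = b
bit (b ∷ m) (suc i) = bit m i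

set : ℕ → Profile → Profile
set zero    []      = true ∷ []
set zero    (_ ∷ m) = true ∷ m
set (suc i) []      = false ∷ set i []
set (suc i) (b ∷ m) = b ∷ set i m

-- Moves the scan on by one cell; the dropped entry belongs to the cell just passed.
next : Profile → Profile
next []      = []
next (_ ∷ m) = m

bit-set : ∀ i m k → bit (set i m) k ≡ true → k ≡ i ⊎ bit m k ≡ true
bit-set zero    []      zero    eq = inj₁ refl
bit-set zero    (_ ∷ m) zero    eq = inj₁ refl
bit-set zero    (_ ∷ m) (suc k) eq = inj₂ eq
bit-set (suc i) []      (suc k) eq = [ inj₁ ∘ cong suc , inj₂ ]′ (bit-set i [] k eq)
bit-set (suc i) (b ∷ m) zero    eq = inj₂ eq
bit-set (suc i) (b ∷ m) (suc k) eq = [ inj₁ ∘ cong suc , inj₂ ]′ (bit-set i m k eq)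

bit-foldr-set : ∀ os m k → bit (foldr set m os) k ≡ true → k ∈ os ⊎ bit m k ≡ true
bit-foldr-set []       m k eq = inj₂ eq
bit-foldr-set (o ∷ os) m k eq with bit-set o (foldr set m os) k eq
... | inj₁ k≡o = inj₁ (here k≡o)
... | inj₂ eq′ = [ inj₁ ∘ there , inj₂ ]′ (bit-foldr-set os m k eq′)

bit-next : ∀ m i → bit (next m) i ≡ bit m (suc i)
bit-next []      i = refl
bit-next (_ ∷ m) i = refl

-- A potential on the profiles at the top of a column, as a decision tree on
-- the entries of the profile. A leaf corresponds to the profile consisting
-- of the entries found to be true on the way; entries found to be false are
-- deliberately forgotten.
data Potential : Set where
  leaf : ℕ → Potential
  node : ℕ → Potential → Potential → Potential

value : Potential → Profile → ℕ
value (leaf v)     m = v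
value (node i l h) m = if bit m i then value h m else value l m

every : (Orientation → Bool) → Bool
every f = f stemDown ∧ f stemUp ∧ f stemRight ∧ f stemLeft

every-sound : ∀ f → every f ≡ true → ∀ k → f k ≡ true
every-sound f eq stemDown  = ∧-conicalˡ (f stemDown) _ eq
every-sound f eq stemUp    = ∧-conicalˡ (f stemUp) _ (∧-conicalʳ (f stemDown) _ eq)
every-sound f eq stemRight =
  ∧-conicalˡ (f stemRight) _ (∧-conicalʳ (f stemUp) _ (∧-conicalʳ (f stemDown) _ eq))
every-sound f eq stemLeft  =
  ∧-conicalʳ (f stemRight) _ (∧-conicalʳ (f stemUp) _ (∧-conicalʳ (f stemDown) _ eq))

-- Every way of filling the remaining j cells of a column, from row r on, ends
-- in a profile whose value is at most b minus the accumulated gain g, each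
-- tetromino gaining 17.
columnFits : Potential → ℕ → ℕ → ℕ → Profile → ℕ → Bool
columnFits S b zero    r m g = value S m ℕ.+ g ≤ᵇ b
columnFits S b (suc j) r m g =
  columnFits S b j (suc r) (next m) g ∧
  (bit m 0 ∨ every λ k →
    not (allowed k r) ∨ any (bit m) (offsets k) ∨
    columnFits S b j (suc r) (next (foldr set m (offsets k))) (17 ℕ.+ g))

opaque

  -- Opaque since unfolding nine rows of an unknown profile is too expensive.
  wholeColumnFits : Potential → ℕ → Profile → Bool
  wholeColumnFits S b m = columnFits S b 9 0 m 0

-- The first tree stays whole, since it evaluates the profiles at the end of the column; the second
-- is the subtree still to be visited. The profile collects the entries that are true on the path to
-- it.
leavesFit : Potential → Potential → Profile → Bool
leavesFit S (leaf v)     m = wholeColumnFits S (38 ℕ.+ v) m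
leavesFit S (node i l h) m = leavesFit S l m ∧ leavesFit S h (set i m)

-- The smaller profile knows of fewer covered cells and so permits more continuations.
_⊑_ : Profile → Profile → Set
m ⊑ m′ = ∀ i → bit m i ≡ true → bit m′ i ≡ true

-- The actual profile `m′` leads to one leaf, and the entries found true on the way form `m″`. The
-- check at that leaf was made for `m″`, which claims nothing that `m′` does not.
leavesFit-sound : ∀ S U m m′ → m ⊑ m′ → leavesFit S U m ≡ true →
  ∃ λ m″ → m″ ⊑ m′ × wholeColumnFits S (38 ℕ.+ value U m′) m″ ≡ true
leavesFit-sound S (leaf v)     m m′ m⊑m′ eq = m , m⊑m′ , eq
leavesFit-sound S (node i l h) m m′ m⊑m′ eq with bit m′ i in bit≡
... | false = leavesFit-sound S l m m′ m⊑m′ (∧-conicalˡ (leavesFit S l m) _ eq)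
... | true  = leavesFit-sound S h (set i m) m′ ⊑′ (∧-conicalʳ (leavesFit S l m) _ eq)
  where
  ⊑′ : set i m ⊑ m′
  ⊑′ k eq′ with bit-set i m k eq′
  ... | inj₁ refl = bit≡
  ... | inj₂ eq″  = m⊑m′ k eq″

-- Scanning a configuration cell by cell and column by column.

-- Disjointness in terms of cell numbers, the language of profiles. Inside the strip it follows from
-- disjointness of cells by `pos-injective`.
Apart : Tetro → Tetro → Set
Apart t u = ∀ x y → x ∈ cells t → y ∈ cells u → pos x ≢ pos y

Apart-sym : ∀ {t u} → Apart t u → Apart u t
Apart-sym t#u x y x∈u y∈t eq = t#u y x y∈t x∈u (sym eq)

-- The invariant of the scan at position `p`, for a tetromino that is still to come. Those anchored
-- earlier have left the list, and what remains of them is their trace in `m`, which `avoids`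
-- respects.
record Beyond (n p : ℕ) (m : Profile) (t : Tetro) : Set where
  field
    inside : All (InRect 9 n) (cells t)
    from   : p ≤ pos (anchor t)
    avoids : ∀ {x} i → x ∈ cells t → bit m i ≡ true → i ℕ.+ p ≢ pos x

Config : ℕ → ℕ → Profile → List Tetro → Set
Config n p m ts = All (Beyond n p m) ts × AllPairs Apart ts

-- A smaller profile forbids fewer cells. This is the step that justifies forgetting entries at the
-- leaves of a potential.
weaken : ∀ {n p m m′ ts} → m ⊑ m′ → Config n p m′ ts → Config n p m ts
weaken m⊑m′ (bs , as) = All.map (λ b → let open Beyond b in record
  { inside = inside ; from = from ; avoids = λ i x∈ eq → avoids i x∈ (m⊑m′ i eq) }) bs , as

Beyond-next : ∀ {n p m t} → pos (anchor t) ≢ p → Beyond n p m t → Beyond n (suc p) (next m) t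
Beyond-next {n} {p} {m} ≢p b = record
  { inside = inside
  ; from   = ℕ.≤∧≢⇒< from (≢p ∘ sym)
  ; avoids = λ i x∈ eq eq′ → avoids (suc i) x∈ (trans (sym (bit-next m i)) eq) (trans (sym (ℕ.+-suc i p)) eq′)
  }
  where open Beyond b

-- A newly marked entry is an offset of `t`, which `offset-cell` turns back into a cell of `t`;
-- being apart from `t`, the tetromino `u` misses it.
Beyond-set : ∀ {n m t u} → let m′ = foldr set m (offsets (Tetro.orient t)) in
  Apart t u → Beyond n (pos (anchor t)) m u → Beyond n (pos (anchor t)) m′ u
Beyond-set {m = m} {t} t#u b = record
  { inside = inside
  ; from   = from
  ; avoids = λ {x} i x∈ eq eq′ → [
      (λ i∈ → let y , y∈ , eq″ = offset-cell t i∈ in t#u y x y∈ x∈ (trans (sym eq″) eq′)) ,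
      (λ eq″ → avoids i x∈ eq″ eq′) ]′ (bit-foldr-set (offsets (Tetro.orient t)) m i eq)
  }
  where open Beyond b

any-false : ∀ {f : ℕ → Bool} os → (∀ {o} → o ∈ os → f o ≢ true) → any f os ≡ false
any-false         []       h = refl
any-false {f = f} (o ∷ os) h with f o in eq
... | true  = contradiction eq (h (here refl))
... | false = any-false os (h ∘ there)

-- The list of tetrominoes is never sorted by anchors. Instead, the one anchored at the scanned cell
-- is brought to the front when the scan arrives there.
extract : ∀ {A : Set} {t : A} {ts} → t ∈ ts → ∃ λ us → ts ↭ t ∷ us
extract {t = t} t∈ with ∈-∃++ t∈
... | ys , zs , refl = ys ++ zs , shift t ys zs

∨-resolve : ∀ {x y} → x ≡ false → x ∨ y ≡ true → y ≡ true
∨-resolve refl eq = eq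

-- The check offers three escapes from placing a tetromino: the cell is marked, the row is wrong for
-- the orientation, or the shape meets a marked cell. Refuting them one after the other leaves the
-- recursive check.
place : ∀ S b j r m g k → allowed k r ≡ true → bit m 0 ≢ true → any (bit m) (offsets k) ≡ false →
  columnFits S b (suc j) r m g ≡ true →
  columnFits S b j (suc r) (next (foldr set m (offsets k))) (17 ℕ.+ g) ≡ true
place S b j r m g k ok vacant free eq =
  ∨-resolve free (∨-resolve (cong not ok) (every-sound placed
    (∨-resolve (¬-not vacant) (∧-conicalʳ (columnFits S b j (suc r) (next m) g) _ eq)) k))
  where
  placed : Orientation → Bool
  placed k = not (allowed k r) ∨ any (bit m) (offsets k) ∨
    columnFits S b j (suc r) (next (foldr set m (offsets k))) (17 ℕ.+ g)

-- The scan preserves `17 * length ts + g`: passing over a cell changes neither term, and placing a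
-- tetromino moves 17 from the first to the second. The bound for the `q` columns to the right is a
-- parameter, which keeps the induction over columns separate.
columnFits-sound : ∀ S b n c q →
  (∀ m ts → Config n (suc c ℕ.* 9) m ts → 17 ℕ.* length ts ≤ 38 ℕ.* q ℕ.+ value S m) →
  ∀ j r m g ts → j ℕ.+ r ≡ 9 → columnFits S b j r m g ≡ true → Config n (r ℕ.+ c ℕ.* 9) m ts →
  17 ℕ.* length ts ℕ.+ g ≤ 38 ℕ.* q ℕ.+ b
-- At `r = 9` the position `9 + c * 9` is by computation the top of column `suc c`, where `ih`
-- applies.
columnFits-sound S b n c q ih zero .9 m g ts refl fits conf = begin
  17 ℕ.* length ts ℕ.+ g           ≤⟨ ℕ.+-monoˡ-≤ g (ih m ts conf) ⟩
  38 ℕ.* q ℕ.+ value S m ℕ.+ g     ≡⟨ ℕ.+-assoc (38 ℕ.* q) (value S m) g ⟩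
  38 ℕ.* q ℕ.+ (value S m ℕ.+ g)   ≤⟨ ℕ.+-monoʳ-≤ (38 ℕ.* q) (ℕ.≤ᵇ⇒≤ _ b (Equivalence.from T-≡ fits)) ⟩
  38 ℕ.* q ℕ.+ b                   ∎
  where open ℕ.≤-Reasoning
columnFits-sound S b n c q ih (suc j) r m g ts j+r fits conf@(bs , as)
  with Any.any? (λ t → pos (anchor t) ℕ.≟ r ℕ.+ c ℕ.* 9) ts
... | no ¬anchored =
  columnFits-sound S b n c q ih j (suc r) (next m) g ts (trans (ℕ.+-suc j r) j+r)
    (∧-conicalˡ (columnFits S b j (suc r) (next m) g) _ fits)
    (All.zipWith (λ (≢p , b) → Beyond-next ≢p b) (All.¬Any⇒All¬ ts ¬anchored , bs) , as)
... | yes anchored with find anchored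
...   | t , t∈ts , at-p with extract t∈ts
...     | us , ts↭ with All-resp-↭ ts↭ bs
                      | Permutation.AllPairs-resp-↭ (setoid Tetro) Apart-sym (resp₂ Apart) (↭⇒↭ₛ ts↭) as
...       | bt ∷ bus | t#us ∷ aus = begin
  17 ℕ.* length ts ℕ.+ g              ≡⟨ cong (λ l → 17 ℕ.* l ℕ.+ g) (↭-length ts↭) ⟩
  17 ℕ.* suc (length us) ℕ.+ g        ≡⟨ rearrange (length us) g ⟩
  17 ℕ.* length us ℕ.+ (17 ℕ.+ g)     ≤⟨ columnFits-sound S b n c q ih j (suc r) (next m′) (17 ℕ.+ g) us
                                           (trans (ℕ.+-suc j r) j+r) fits′ (bus′ , aus) ⟩
  38 ℕ.* q ℕ.+ b                      ∎
  where
  open ℕ.≤-Reasoning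
  open Beyond bt
  k  = Tetro.orient t
  m′ = foldr set m (offsets k)

  rearrange : ∀ l g → 17 ℕ.* suc l ℕ.+ g ≡ 17 ℕ.* l ℕ.+ (17 ℕ.+ g)
  rearrange = solve-∀

  -- The row condition concerns the anchor, the check the scanned row. The two cells have the same
  -- number and both rows are below 9, for `r` because `suc j + r ≡ 9`.
  row≡r : proj₁ (anchor t) ≡ r
  row≡r = cong proj₁ (pos-injective (anchor t) (r , c) (proj₁ (All.lookup inside (anchor∈cells t)))
    (subst (r <_) j+r (ℕ.m<n+m r (s≤s z≤n))) at-p)

  ok : allowed k r ≡ true
  ok = trans (cong (allowed k) (sym row≡r)) (InRect⇒allowed t inside)

  -- Neither the scanned cell nor any other cell of `t` is marked, as `t` itself satisfies the
  -- invariant of the scan.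
  fits′ : columnFits S b j (suc r) (next m′) (17 ℕ.+ g) ≡ true
  fits′ = place S b j r m g k ok (λ eq → avoids 0 (anchor∈cells t) eq (sym at-p))
    (any-false (offsets k) λ {o} o∈ eq →
      let x , x∈ , eq′ = offset-cell t o∈ in avoids o x∈ eq (trans (cong (o ℕ.+_) (sym at-p)) eq′))
    fits

  -- No second tetromino is anchored at the scanned cell, since it would share that cell with `t`;
  -- so the scan may advance once `t` has been removed and marked.
  bus′ : All (Beyond n (suc (r ℕ.+ c ℕ.* 9)) (next m′)) us
  bus′ = All.zipWith (λ {u} (t#u , bu) → Beyond-next
      (λ eq → t#u (anchor t) (anchor u) (anchor∈cells t) (anchor∈cells u) (trans at-p (sym eq)))
      (subst (λ p → Beyond n p m′ u) at-p
        (Beyond-set {t = t} t#u (subst (λ p → Beyond n p m u) (sym at-p) bu))))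
    (t#us , bus)

opaque
  unfolding wholeColumnFits

  wholeColumnFits-sound : ∀ S b n c q →
    (∀ m ts → Config n (suc c ℕ.* 9) m ts → 17 ℕ.* length ts ≤ 38 ℕ.* q ℕ.+ value S m) →
    ∀ m ts → wholeColumnFits S b m ≡ true → Config n (c ℕ.* 9) m ts →
    17 ℕ.* length ts ≤ 38 ℕ.* q ℕ.+ b
  wholeColumnFits-sound S b n c q ih m ts fits conf = subst (_≤ 38 ℕ.* q ℕ.+ b) (ℕ.+-identityʳ _)
    (columnFits-sound S b n c q ih 9 0 m 0 ts refl fits conf)

-- The column inequalities telescope: 17 per tetromino in a column is paid by 38 and the drop of the
-- potential. After the last column no tetromino is left, and the inequality remains true because
-- the values are natural numbers.
potential-bound : ∀ S → leavesFit S S [] ≡ true → ∀ n q c m ts → c ℕ.+ q ≡ n →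
  Config n (c ℕ.* 9) m ts → 17 ℕ.* length ts ≤ 38 ℕ.* q ℕ.+ value S m
potential-bound S fit n zero    c m []       eq conf = z≤n
-- An anchor numbered `n * 9` or higher would lie to the right of the rectangle.
potential-bound S fit n zero    c m (t ∷ ts) eq (bt ∷ _ , _) = contradiction beyond (ℕ.<⇒≱ before)
  where
  open Beyond bt
  beyond : n ℕ.* 9 ≤ pos (anchor t)
  beyond = subst (λ c → c ℕ.* 9 ≤ pos (anchor t)) (trans (sym (ℕ.+-identityʳ c)) eq) from
  before : pos (anchor t) < n ℕ.* 9
  before with All.lookup inside (anchor∈cells t)
  ... | r<9 , c<n = ℕ.≤-trans (ℕ.+-monoˡ-≤ _ r<9) (ℕ.*-monoˡ-≤ 9 c<n)
potential-bound S fit n (suc q) c m ts eq conf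
  with leavesFit-sound S S [] m (λ _ ()) fit
... | m″ , m″⊑m , fits = begin
  17 ℕ.* length ts                        ≤⟨ wholeColumnFits-sound S _ n c q ih m″ ts fits (weaken m″⊑m conf) ⟩
  38 ℕ.* q ℕ.+ (38 ℕ.+ value S m)         ≡⟨ rearrange q (value S m) ⟩
  38 ℕ.* suc q ℕ.+ value S m              ∎
  where
  open ℕ.≤-Reasoning
  ih : ∀ m ts → Config n (suc c ℕ.* 9) m ts → 17 ℕ.* length ts ≤ 38 ℕ.* q ℕ.+ value S m
  ih m ts = potential-bound S fit n q (suc c) m ts (trans (sym (ℕ.+-suc c q)) eq)
  rearrange : ∀ q v → 38 ℕ.* q ℕ.+ (38 ℕ.+ v) ≡ 38 ℕ.* suc q ℕ.+ v
  rearrange = solve-∀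

IsTTiling⇒Config : ∀ n ts → IsTTiling 9 n ts → Config n 0 [] ts
IsTTiling⇒Config n ts (inside , unique) =
  All.map (λ i → record { inside = i ; from = z≤n ; avoids = λ _ _ () }) inside ,
  apart inside (Unique-concatMap⁻ ts unique)
  where
  apart : ∀ {ts} → All (λ t → All (InRect 9 n) (cells t)) ts →
    AllPairs (λ t u → Disjoint (cells t) (cells u)) ts → AllPairs Apart ts
  apart []       []       = []
  apart (i ∷ is) (d ∷ ds) = All.zipWith (λ (i′ , d) x y x∈ y∈ eq → d (x∈ , subst (_∈ _)
      (sym (pos-injective x y (proj₁ (All.lookup i x∈)) (proj₁ (All.lookup i′ y∈)) eq)) y∈)) (is , d)
    ∷ apart is ds

-- The explicit potential and its verification.

-- The value of a profile bounds the maximum of 17 · tetrominoes - 38 · columns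
-- over all continuations. It was found by value iteration over all profiles,
-- after which entries that do not matter were dropped.
potential : Potential
potential =
  (node 2 (node 1 (node 3 (node 4 (node 6 (node 7 (node 0 (node 5 (node 8 (leaf 94) (leaf 87))
  (node 8 (leaf 90) (leaf 85))) (node 5 (node 8 (leaf 87) (leaf 85)) (node 8 (leaf 83) (leaf
  80)))) (node 5 (node 0 (node 8 (leaf 87) (node 17 (node 16 (leaf 86) (leaf 79)) (leaf 78)))
  (node 8 (leaf 82) (node 17 (node 16 (leaf 81) (leaf 75)) (leaf 75)))) (node 8 (node 0 (leaf 83)
  (leaf 80)) (node 17 (node 16 (leaf 80) (node 0 (leaf 74) (leaf 73))) (node 0 (leaf 74) (leaf
  71)))))) (node 5 (node 7 (node 0 (leaf 85) (leaf 82)) (node 0 (node 8 (node 16 (leaf 83) (leaf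
  79)) (node 15 (node 17 (leaf 76) (leaf 74)) (leaf 74))) (node 8 (node 16 (leaf 79) (leaf 75))
  (node 17 (node 15 (node 16 (leaf 75) (leaf 73)) (leaf 73)) (leaf 71))))) (node 8 (node 0 (node
  16 (node 14 (node 15 (leaf 82) (leaf 77)) (leaf 77)) (leaf 74)) (node 14 (node 16 (node 15 (leaf
  78) (node 7 (leaf 71) (leaf 69))) (leaf 73)) (leaf 72))) (node 14 (node 7 (node 0 (node 15 (leaf
  79) (leaf 74)) (node 15 (leaf 75) (leaf 73))) (node 15 (node 0 (node 17 (leaf 74) (leaf 71))
  (node 17 (leaf 73) (leaf 68))) (node 0 (leaf 67) (leaf 62)))) (node 0 (node 7 (leaf 75) (node 17
  (node 16 (leaf 72) (leaf 69)) (leaf 67))) (node 7 (leaf 71) (node 17 (node 16 (leaf 71) (leaf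
  62)) (leaf 62)))))))) (node 5 (node 7 (node 0 (node 8 (node 6 (leaf 90) (leaf 82)) (leaf 82))
  (node 8 (node 6 (leaf 80) (leaf 76)) (leaf 74))) (node 8 (node 16 (node 15 (node 0 (leaf 82)
  (leaf 76)) (node 0 (leaf 78) (leaf 73))) (node 0 (leaf 75) (leaf 70))) (node 0 (node 6 (node 16
  (node 17 (leaf 80) (leaf 74)) (leaf 75)) (node 17 (node 15 (node 16 (leaf 75) (leaf 73)) (leaf
  73)) (leaf 74))) (node 6 (node 16 (node 17 (leaf 80) (leaf 68)) (leaf 70)) (node 17 (node 15
  (node 16 (leaf 70) (leaf 65)) (leaf 63)) (leaf 65)))))) (node 15 (node 6 (node 8 (node 13 (node
  0 (node 7 (node 14 (leaf 84) (leaf 79)) (node 14 (leaf 82) (leaf 77))) (node 14 (leaf 78) (node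
  7 (leaf 73) (leaf 72)))) (node 0 (leaf 79) (leaf 74))) (node 13 (node 0 (node 7 (node 14 (leaf
  80) (leaf 75)) (node 14 (node 16 (node 17 (leaf 78) (leaf 70)) (leaf 73)) (node 17 (node 16
  (leaf 72) (leaf 69)) (leaf 67)))) (node 7 (node 14 (leaf 77) (leaf 71)) (node 14 (node 16 (node
  17 (leaf 69) (leaf 65)) (leaf 65)) (node 17 (node 16 (leaf 64) (leaf 62)) (leaf 62))))) (node 0
  (node 7 (leaf 75) (node 17 (node 16 (leaf 73) (leaf 70)) (leaf 69))) (node 7 (leaf 69) (leaf
  65))))) (node 13 (node 0 (node 8 (node 14 (node 16 (leaf 77) (leaf 73)) (node 16 (leaf 70) (leaf
  69))) (node 14 (node 7 (leaf 75) (node 17 (node 16 (leaf 73) (leaf 69)) (leaf 67))) (node 7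
  (leaf 70) (node 16 (node 17 (leaf 69) (leaf 61)) (leaf 62))))) (node 7 (node 14 (leaf 69) (leaf
  65)) (node 8 (node 14 (node 16 (leaf 69) (leaf 65)) (node 16 (leaf 65) (leaf 62))) (node 17
  (node 14 (node 16 (leaf 63) (leaf 62)) (node 16 (leaf 62) (leaf 58))) (node 14 (leaf 62) (leaf
  54)))))) (node 17 (node 7 (node 0 (leaf 71) (leaf 68)) (node 8 (node 16 (node 0 (leaf 71) (leaf
  66)) (leaf 65)) (node 0 (node 16 (leaf 70) (leaf 62)) (leaf 60)))) (node 7 (leaf 72) (node 0
  (leaf 63) (leaf 60)))))) (node 7 (node 0 (node 6 (leaf 79) (leaf 73)) (node 6 (leaf 73) (leaf
  63))) (node 8 (node 14 (node 13 (node 0 (leaf 71) (leaf 66)) (node 0 (leaf 67) (leaf 62))) (node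
  0 (leaf 67) (leaf 62))) (node 16 (node 0 (node 14 (node 13 (leaf 64) (leaf 63)) (leaf 61)) (leaf
  56)) (node 0 (leaf 62) (leaf 58)))))))) (node 4 (node 6 (node 7 (node 0 (node 8 (node 5 (leaf
  90) (leaf 88)) (node 5 (leaf 83) (leaf 82))) (node 5 (leaf 82) (node 8 (leaf 80) (leaf 74))))
  (node 0 (node 16 (node 17 (node 5 (leaf 83) (leaf 82)) (node 5 (leaf 75) (leaf 71))) (node 5
  (leaf 76) (leaf 73))) (node 8 (node 5 (leaf 79) (leaf 76)) (node 16 (node 17 (leaf 75) (node 5
  (leaf 71) (leaf 68))) (node 5 (leaf 73) (leaf 66)))))) (node 5 (node 7 (node 0 (leaf 82) (leaf
  74)) (node 8 (node 16 (node 0 (node 15 (leaf 82) (leaf 79)) (leaf 73)) (leaf 73)) (node 17 (node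
  0 (leaf 73) (node 16 (leaf 66) (leaf 65))) (node 0 (leaf 71) (leaf 65))))) (node 8 (node 14
  (node 16 (node 0 (node 15 (leaf 79) (node 7 (leaf 73) (leaf 71))) (node 15 (leaf 73) (node 7
  (leaf 73) (leaf 66)))) (node 0 (leaf 72) (leaf 66))) (node 0 (leaf 71) (node 7 (leaf 66) (leaf
  65)))) (node 14 (node 7 (node 15 (leaf 76) (node 0 (leaf 73) (leaf 68))) (node 15 (node 0 (node
  17 (leaf 73) (leaf 71)) (node 17 (leaf 66) (leaf 63))) (node 0 (node 16 (leaf 64) (leaf 62))
  (leaf 60)))) (node 7 (node 0 (leaf 71) (leaf 66)) (node 0 (node 16 (node 17 (leaf 66) (leaf 64))
  (leaf 64)) (leaf 58))))))) (node 6 (node 7 (node 5 (node 0 (node 8 (node 12 (node 13 (leaf 84)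
  (leaf 79)) (leaf 79)) (node 12 (node 13 (leaf 80) (leaf 75)) (leaf 73))) (node 13 (node 8 (node
  12 (leaf 80) (leaf 77)) (node 12 (leaf 74) (leaf 71))) (node 8 (leaf 77) (leaf 75)))) (node 14
  (node 0 (node 8 (node 12 (node 13 (leaf 79) (leaf 73)) (leaf 78)) (node 12 (node 13 (leaf 75)
  (leaf 70)) (leaf 73))) (node 12 (node 13 (node 8 (leaf 77) (leaf 75)) (node 8 (leaf 69) (leaf
  68))) (leaf 66))) (node 8 (node 0 (leaf 76) (leaf 73)) (leaf 66)))) (node 12 (node 8 (node 14
  (node 0 (node 13 (leaf 77) (leaf 71)) (node 13 (leaf 74) (leaf 65))) (node 0 (leaf 66) (leaf
  65))) (node 14 (node 5 (node 13 (node 17 (node 16 (leaf 74) (leaf 66)) (leaf 68)) (leaf 65))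
  (node 0 (node 17 (node 16 (leaf 73) (node 13 (leaf 65) (leaf 60))) (node 13 (leaf 66) (leaf
  60))) (node 16 (node 17 (leaf 69) (node 13 (leaf 65) (leaf 58))) (node 13 (leaf 65) (leaf
  58))))) (node 17 (node 16 (leaf 65) (leaf 60)) (node 0 (leaf 64) (leaf 58))))) (node 5 (node 0
  (node 16 (node 17 (leaf 73) (leaf 64)) (leaf 69)) (node 17 (leaf 63) (leaf 62))) (node 8 (node 0
  (leaf 73) (leaf 66)) (node 16 (node 17 (leaf 71) (node 0 (leaf 64) (leaf 58))) (node 0 (leaf 62)
  (leaf 58))))))) (node 5 (node 8 (node 12 (node 13 (node 16 (node 0 (node 15 (leaf 79) (leaf 74))
  (node 7 (leaf 76) (leaf 71))) (leaf 66)) (node 7 (node 0 (leaf 70) (leaf 68)) (node 0 (leaf 67)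
  (node 15 (leaf 65) (leaf 62))))) (node 0 (node 7 (leaf 73) (node 15 (node 16 (leaf 72) (leaf
  69)) (leaf 67))) (leaf 65))) (node 7 (leaf 75) (node 13 (node 17 (node 0 (node 16 (node 15 (leaf
  69) (node 12 (leaf 63) (leaf 62))) (node 12 (leaf 70) (leaf 62))) (node 12 (node 16 (leaf 66)
  (leaf 63)) (leaf 58))) (node 0 (node 12 (leaf 66) (leaf 64)) (node 12 (leaf 63) (leaf 61))))
  (node 0 (leaf 61) (node 15 (leaf 60) (leaf 58)))))) (node 17 (node 13 (node 12 (node 0 (node 14
  (node 7 (leaf 71) (node 8 (node 16 (node 15 (leaf 71) (leaf 67)) (leaf 70)) (node 15 (node 16
  (leaf 70) (leaf 62)) (node 16 (leaf 63) (leaf 62))))) (node 15 (node 7 (leaf 66) (node 8 (node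
  16 (leaf 66) (leaf 64)) (leaf 64))) (node 7 (leaf 67) (node 8 (leaf 64) (leaf 57))))) (node 7
  (node 14 (leaf 66) (leaf 65)) (node 14 (node 16 (node 15 (leaf 65) (node 8 (leaf 62) (leaf 58)))
  (node 15 (leaf 60) (leaf 56))) (node 8 (node 16 (node 15 (leaf 63) (leaf 60)) (leaf 60)) (node
  15 (leaf 60) (leaf 51)))))) (node 7 (node 0 (node 14 (node 15 (leaf 69) (leaf 62)) (leaf 64))
  (node 8 (leaf 61) (leaf 58))) (node 8 (node 0 (node 16 (node 14 (node 15 (leaf 67) (leaf 62))
  (leaf 64)) (leaf 62)) (node 16 (leaf 60) (leaf 58))) (node 0 (node 14 (node 15 (node 16 (leaf
  62) (leaf 61)) (leaf 53)) (node 16 (leaf 62) (leaf 55))) (node 14 (node 15 (leaf 56) (leaf 50))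
  (leaf 54)))))) (node 7 (node 15 (node 14 (leaf 65) (node 0 (node 8 (leaf 61) (leaf 60)) (node 8
  (leaf 60) (leaf 58)))) (node 8 (leaf 61) (node 0 (leaf 61) (leaf 58)))) (node 8 (node 0 (node 15
  (node 16 (node 14 (leaf 64) (leaf 63)) (leaf 60)) (leaf 62)) (node 16 (leaf 60) (leaf 58)))
  (node 16 (node 0 (node 15 (leaf 60) (leaf 56)) (node 15 (leaf 58) (leaf 54))) (node 0 (leaf 53)
  (node 15 (node 14 (leaf 52) (leaf 50)) (leaf 50))))))) (node 7 (leaf 72) (node 12 (node 13 (node
  0 (node 14 (leaf 64) (leaf 58)) (node 14 (node 15 (leaf 58) (leaf 54)) (leaf 54))) (node 0 (leaf
  53) (leaf 52))) (node 0 (node 14 (node 15 (leaf 61) (leaf 53)) (leaf 53)) (leaf 52)))))))))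
  (node 4 (node 5 (node 6 (node 0 (node 7 (node 3 (node 8 (leaf 90) (leaf 85)) (node 8 (leaf 83)
  (leaf 82))) (node 8 (node 3 (leaf 83) (leaf 82)) (node 3 (node 16 (node 17 (leaf 82) (leaf 75))
  (leaf 75)) (node 16 (node 17 (leaf 76) (leaf 71)) (leaf 73))))) (node 3 (node 7 (node 9 (node 10
  (leaf 85) (node 8 (leaf 79) (leaf 75))) (node 8 (leaf 78) (leaf 75))) (node 8 (node 9 (node 10
  (leaf 84) (leaf 77)) (leaf 77)) (node 9 (node 10 (leaf 80) (node 16 (node 17 (leaf 76) (leaf
  69)) (leaf 69))) (node 16 (node 17 (leaf 76) (leaf 69)) (leaf 69))))) (node 8 (node 9 (node 7
  (node 10 (leaf 80) (leaf 77)) (node 10 (leaf 78) (leaf 70))) (node 7 (leaf 74) (leaf 72))) (node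
  7 (node 9 (node 10 (leaf 76) (leaf 72)) (leaf 71)) (node 9 (node 10 (leaf 72) (node 17 (node 16
  (leaf 67) (leaf 62)) (leaf 64))) (node 17 (node 16 (leaf 71) (leaf 62)) (leaf 64))))))) (node 3
  (node 9 (node 10 (node 7 (leaf 84) (node 17 (node 8 (node 16 (node 15 (leaf 79) (leaf 77)) (leaf
  75)) (node 15 (node 16 (leaf 75) (leaf 73)) (leaf 70))) (leaf 71))) (node 7 (leaf 73) (node 17
  (node 15 (node 8 (node 16 (leaf 71) (leaf 69)) (node 16 (leaf 69) (leaf 62))) (node 8 (leaf 70)
  (leaf 62))) (leaf 64)))) (node 7 (leaf 73) (node 17 (node 15 (node 8 (node 16 (leaf 71) (leaf
  69)) (node 16 (leaf 69) (leaf 61))) (node 8 (leaf 69) (leaf 61))) (leaf 62)))) (node 7 (node 9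
  (node 10 (leaf 74) (leaf 66)) (leaf 68)) (node 8 (node 0 (node 16 (node 15 (leaf 76) (leaf 72))
  (leaf 73)) (node 9 (node 10 (leaf 72) (node 16 (leaf 65) (leaf 62))) (node 16 (node 15 (leaf 66)
  (leaf 65)) (leaf 62)))) (node 9 (node 0 (node 17 (node 16 (leaf 68) (leaf 66)) (leaf 65)) (node
  10 (leaf 66) (node 17 (leaf 58) (leaf 56)))) (node 15 (node 17 (node 16 (leaf 58) (leaf 57))
  (leaf 56)) (leaf 57))))))) (node 6 (node 9 (node 10 (node 7 (node 8 (node 3 (leaf 85) (leaf 82))
  (node 3 (leaf 79) (leaf 74))) (node 17 (node 8 (node 3 (leaf 80) (leaf 76)) (node 16 (leaf 79)
  (node 3 (leaf 70) (leaf 68)))) (node 3 (leaf 70) (leaf 68)))) (node 7 (node 3 (node 8 (leaf 78)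
  (leaf 73)) (node 8 (leaf 75) (leaf 66))) (node 8 (node 3 (leaf 73) (leaf 66)) (node 16 (node 17
  (leaf 68) (node 3 (leaf 64) (leaf 59))) (node 3 (leaf 62) (leaf 58)))))) (node 7 (node 3 (node 8
  (leaf 75) (leaf 73)) (node 8 (leaf 73) (leaf 68))) (node 8 (node 3 (leaf 73) (leaf 66)) (node 16
  (node 17 (leaf 72) (node 3 (leaf 64) (leaf 57))) (node 3 (leaf 62) (leaf 57)))))) (node 0 (node
  8 (node 14 (node 15 (node 16 (node 3 (leaf 77) (leaf 72)) (leaf 68)) (node 7 (leaf 72) (node 3
  (leaf 69) (leaf 66)))) (node 3 (leaf 70) (leaf 66))) (node 7 (node 14 (node 3 (node 15 (leaf 76)
  (leaf 70)) (node 15 (leaf 73) (leaf 68))) (node 3 (leaf 70) (leaf 68))) (node 16 (node 17 (node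
  3 (node 15 (leaf 70) (leaf 64)) (leaf 68)) (node 14 (node 15 (leaf 67) (node 3 (leaf 64) (leaf
  60))) (node 3 (leaf 64) (leaf 58)))) (node 14 (node 3 (node 15 (leaf 71) (leaf 62)) (node 15
  (leaf 66) (leaf 60))) (node 3 (leaf 62) (leaf 60)))))) (node 3 (node 9 (node 10 (leaf 72) (node
  7 (node 15 (node 14 (leaf 70) (leaf 65)) (leaf 62)) (node 8 (node 16 (node 14 (node 15 (leaf 67)
  (leaf 61)) (leaf 64)) (leaf 62)) (node 14 (node 15 (leaf 62) (leaf 53)) (node 17 (node 16 (leaf
  61) (leaf 57)) (leaf 53)))))) (node 7 (node 14 (node 15 (leaf 70) (leaf 61)) (node 8 (leaf 64)
  (leaf 62))) (node 8 (node 16 (node 14 (node 15 (leaf 67) (leaf 61)) (leaf 64)) (leaf 62)) (node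
  14 (node 15 (leaf 61) (node 16 (leaf 53) (leaf 52))) (node 17 (node 16 (leaf 59) (leaf 55))
  (leaf 53)))))) (node 9 (node 7 (node 15 (node 10 (leaf 66) (node 14 (leaf 66) (leaf 58))) (node
  10 (leaf 66) (node 8 (leaf 62) (leaf 58)))) (node 8 (node 10 (leaf 66) (node 14 (node 16 (node
  15 (leaf 65) (leaf 60)) (leaf 58)) (leaf 57))) (node 10 (leaf 68) (node 14 (node 15 (node 17
  (leaf 58) (leaf 54)) (leaf 50)) (node 17 (leaf 50) (leaf 49)))))) (node 7 (node 15 (node 14
  (leaf 65) (leaf 58)) (leaf 57)) (node 8 (node 14 (node 16 (node 15 (leaf 65) (leaf 57)) (leaf
  57)) (leaf 60)) (node 14 (node 15 (node 17 (leaf 57) (leaf 54)) (node 16 (leaf 50) (leaf 49)))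
  (node 17 (leaf 54) (leaf 49)))))))))) (node 6 (node 7 (node 9 (node 10 (node 12 (node 5 (node 8
  (node 13 (leaf 80) (leaf 77)) (leaf 74)) (node 14 (node 13 (node 8 (leaf 77) (leaf 75)) (node 8
  (leaf 70) (leaf 68))) (node 8 (leaf 73) (leaf 68)))) (node 5 (node 8 (leaf 73) (leaf 70)) (node
  8 (leaf 68) (leaf 65)))) (node 3 (node 5 (node 8 (leaf 73) (leaf 69)) (node 8 (leaf 69) (leaf
  65))) (node 5 (node 12 (node 13 (node 8 (leaf 71) (leaf 65)) (node 8 (leaf 70) (leaf 67))) (leaf
  64)) (node 12 (node 14 (node 13 (leaf 66) (node 8 (leaf 59) (leaf 58))) (node 8 (leaf 62) (leaf
  58))) (node 8 (leaf 62) (leaf 58)))))) (node 3 (node 5 (node 8 (leaf 74) (leaf 68)) (node 14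
  (node 13 (leaf 68) (leaf 67)) (node 8 (leaf 64) (leaf 62)))) (node 5 (node 12 (node 8 (node 13
  (leaf 70) (leaf 67)) (leaf 65)) (node 8 (leaf 63) (leaf 62))) (node 14 (node 12 (node 13 (leaf
  67) (node 8 (leaf 60) (leaf 58))) (node 8 (leaf 60) (leaf 58))) (node 8 (leaf 62) (leaf 58))))))
  (node 8 (node 0 (node 14 (node 12 (node 13 (leaf 74) (leaf 66)) (leaf 66)) (leaf 66)) (node 3
  (node 9 (node 10 (leaf 72) (node 13 (node 14 (leaf 65) (leaf 64)) (leaf 63))) (node 13 (node 14
  (leaf 66) (leaf 64)) (leaf 63))) (node 5 (node 9 (node 10 (leaf 72) (leaf 63)) (leaf 63)) (node
  9 (node 10 (leaf 67) (node 14 (node 13 (node 12 (leaf 63) (leaf 60)) (leaf 60)) (leaf 57)))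
  (node 14 (node 13 (node 12 (leaf 63) (leaf 58)) (leaf 60)) (leaf 60)))))) (node 5 (node 9 (node
  10 (node 12 (node 13 (node 17 (node 16 (leaf 72) (leaf 68)) (leaf 68)) (leaf 63)) (node 16 (leaf
  64) (leaf 62))) (node 12 (node 13 (node 16 (node 17 (leaf 63) (leaf 57)) (leaf 58)) (node 3
  (leaf 56) (leaf 54))) (node 16 (node 17 (leaf 59) (leaf 53)) (leaf 55)))) (node 12 (node 13
  (node 16 (node 17 (leaf 63) (node 3 (leaf 58) (leaf 57))) (leaf 58)) (node 3 (leaf 56) (leaf
  54))) (node 16 (node 17 (leaf 59) (leaf 53)) (leaf 55)))) (node 9 (node 10 (node 12 (node 14
  (node 3 (node 13 (node 16 (node 17 (leaf 68) (leaf 65)) (leaf 64)) (leaf 63)) (node 16 (node 17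
  (leaf 67) (node 13 (leaf 65) (leaf 58))) (node 13 (leaf 63) (leaf 58)))) (node 17 (node 16 (leaf
  63) (leaf 60)) (leaf 58))) (node 17 (node 16 (leaf 62) (leaf 57)) (leaf 57))) (node 12 (node 14
  (node 16 (node 17 (leaf 63) (node 13 (leaf 54) (leaf 52))) (node 13 (leaf 56) (leaf 52))) (node
  16 (node 17 (leaf 59) (leaf 49)) (leaf 52))) (leaf 52))) (node 12 (node 14 (node 16 (node 17
  (leaf 63) (node 13 (leaf 54) (leaf 52))) (node 3 (node 13 (leaf 57) (leaf 56)) (node 13 (leaf
  56) (leaf 52)))) (node 16 (node 17 (leaf 59) (node 3 (leaf 53) (leaf 49))) (leaf 54))) (node 16
  (leaf 52) (leaf 49))))))) (node 5 (node 7 (node 0 (node 12 (node 13 (leaf 74) (leaf 68)) (leaf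
  68)) (node 3 (node 9 (node 10 (leaf 74) (leaf 68)) (leaf 68)) (node 9 (node 10 (leaf 72) (node
  13 (node 12 (leaf 65) (leaf 60)) (leaf 58))) (node 13 (node 12 (leaf 65) (leaf 58)) (node 8
  (leaf 62) (leaf 58)))))) (node 8 (node 0 (node 16 (node 12 (node 13 (node 15 (leaf 74) (leaf
  69)) (node 15 (leaf 66) (leaf 63))) (leaf 65)) (node 12 (leaf 63) (leaf 62))) (node 3 (node 16
  (node 9 (node 10 (leaf 72) (node 15 (leaf 66) (leaf 62))) (node 15 (leaf 66) (leaf 61))) (node 9
  (node 10 (leaf 63) (leaf 60)) (leaf 58))) (node 9 (node 10 (leaf 68) (node 12 (node 13 (node 16
  (node 15 (leaf 63) (leaf 57)) (leaf 58)) (node 16 (node 15 (leaf 58) (leaf 53)) (leaf 56)))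
  (leaf 54))) (node 12 (node 16 (node 13 (leaf 62) (node 15 (leaf 61) (leaf 53))) (leaf 56)) (node
  16 (node 15 (leaf 59) (leaf 54)) (leaf 55)))))) (node 9 (node 10 (node 13 (node 12 (node 17
  (node 16 (node 15 (leaf 68) (leaf 63)) (leaf 65)) (leaf 65)) (node 15 (leaf 58) (leaf 57)))
  (node 17 (node 15 (leaf 60) (leaf 58)) (leaf 58))) (node 12 (node 13 (node 15 (node 17 (leaf 58)
  (leaf 54)) (leaf 56)) (node 3 (leaf 55) (node 17 (leaf 50) (leaf 49)))) (node 17 (node 16 (leaf
  52) (leaf 50)) (leaf 50)))) (node 12 (node 13 (node 15 (node 16 (node 3 (leaf 58) (node 17 (leaf
  58) (leaf 54))) (node 3 (leaf 57) (leaf 54))) (leaf 56)) (node 17 (leaf 52) (node 3 (leaf 50)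
  (leaf 49)))) (node 17 (node 16 (leaf 52) (leaf 51)) (leaf 50)))))) (node 9 (node 10 (node 12
  (node 13 (node 15 (node 7 (node 14 (leaf 68) (leaf 65)) (node 8 (node 16 (node 14 (leaf 66)
  (leaf 65)) (leaf 60)) (node 3 (node 14 (node 16 (leaf 64) (leaf 62)) (node 16 (node 17 (leaf 62)
  (leaf 54)) (leaf 57))) (node 17 (node 16 (node 14 (leaf 63) (leaf 60)) (leaf 60)) (node 14 (leaf
  58) (leaf 54)))))) (node 7 (node 3 (leaf 64) (leaf 63)) (node 8 (node 14 (leaf 63) (node 3 (leaf
  61) (leaf 60))) (node 17 (node 14 (node 3 (leaf 56) (leaf 54)) (leaf 51)) (leaf 54))))) (node 7
  (node 14 (node 15 (leaf 65) (node 8 (leaf 60) (leaf 58))) (node 8 (leaf 60) (leaf 58))) (node 8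
  (node 16 (leaf 60) (leaf 58)) (node 16 (node 17 (node 15 (leaf 58) (leaf 54)) (leaf 52)) (leaf
  52))))) (node 8 (node 16 (node 15 (leaf 60) (leaf 59)) (leaf 57)) (node 14 (node 15 (node 7
  (leaf 59) (node 17 (leaf 56) (leaf 54))) (node 7 (leaf 54) (leaf 50))) (node 7 (leaf 53) (leaf
  52))))) (node 15 (node 12 (node 17 (node 13 (node 3 (node 8 (node 14 (node 16 (leaf 60) (leaf
  58)) (leaf 57)) (node 7 (leaf 58) (node 14 (leaf 57) (leaf 52)))) (node 16 (node 14 (node 7
  (leaf 58) (node 8 (leaf 57) (leaf 56))) (node 7 (leaf 53) (node 8 (leaf 53) (leaf 52)))) (leaf
  52))) (node 14 (node 3 (node 7 (leaf 54) (node 8 (leaf 54) (leaf 53))) (node 7 (leaf 54) (node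
  16 (node 8 (leaf 53) (leaf 52)) (leaf 44)))) (node 3 (leaf 51) (node 7 (leaf 51) (node 8 (leaf
  49) (node 16 (leaf 46) (leaf 44))))))) (node 3 (node 7 (leaf 68) (leaf 49)) (node 7 (leaf 55)
  (node 13 (node 14 (leaf 49) (leaf 47)) (node 14 (leaf 44) (leaf 42)))))) (node 7 (leaf 52) (node
  8 (leaf 50) (node 14 (leaf 45) (leaf 44))))) (node 7 (node 3 (leaf 58) (node 8 (leaf 53) (node
  13 (node 12 (leaf 53) (leaf 52)) (leaf 52)))) (node 8 (node 3 (node 13 (leaf 55) (leaf 53))
  (node 14 (node 12 (leaf 53) (leaf 51)) (leaf 50))) (node 13 (node 12 (node 14 (node 16 (leaf 47)
  (leaf 45)) (leaf 44)) (leaf 44)) (node 3 (leaf 46) (leaf 44))))))) (node 15 (node 12 (node 17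
  (node 13 (node 3 (node 7 (node 14 (leaf 62) (node 8 (leaf 58) (leaf 54))) (node 8 (node 14 (node
  16 (leaf 61) (leaf 57)) (node 16 (leaf 59) (leaf 55))) (node 16 (node 14 (leaf 57) (leaf 55))
  (node 14 (leaf 55) (leaf 50))))) (node 8 (node 14 (node 16 (leaf 60) (leaf 56)) (node 16 (leaf
  55) (leaf 54))) (node 16 (node 14 (node 7 (leaf 58) (leaf 56)) (leaf 54)) (leaf 53)))) (node 14
  (node 7 (leaf 54) (node 16 (node 8 (leaf 53) (leaf 52)) (leaf 44))) (node 7 (leaf 52) (node 8
  (node 3 (leaf 50) (leaf 49)) (node 16 (leaf 45) (leaf 42)))))) (node 3 (node 7 (leaf 68) (node
  13 (leaf 50) (leaf 49))) (node 7 (leaf 55) (node 13 (node 14 (leaf 49) (leaf 47)) (node 14 (leaf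
  44) (leaf 42)))))) (node 7 (leaf 52) (node 8 (node 16 (leaf 50) (leaf 49)) (node 14 (leaf 46)
  (leaf 42))))) (node 7 (node 3 (leaf 57) (node 13 (node 12 (leaf 54) (leaf 52)) (leaf 52))) (node
  8 (node 3 (node 14 (node 13 (leaf 57) (leaf 53)) (leaf 53)) (node 14 (node 12 (node 13 (leaf 52)
  (leaf 50)) (leaf 50)) (leaf 50))) (node 13 (node 12 (node 14 (node 3 (leaf 49) (node 16 (leaf
  47) (leaf 45))) (leaf 45)) (leaf 41)) (node 16 (leaf 44) (leaf 43))))))))))) (node 3 (node 6
  (node 5 (node 4 (node 8 (node 9 (node 0 (node 10 (node 7 (leaf 83) (node 11 (leaf 82) (leaf
  81))) (leaf 77)) (node 1 (node 7 (leaf 83) (leaf 82)) (node 11 (node 10 (node 7 (leaf 78) (leaf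
  77)) (node 7 (leaf 74) (leaf 70))) (node 7 (leaf 74) (leaf 71))))) (node 1 (leaf 85) (node 7
  (leaf 74) (leaf 71)))) (node 1 (node 7 (leaf 82) (node 16 (node 17 (leaf 75) (leaf 71)) (leaf
  73))) (node 0 (node 7 (node 10 (leaf 79) (leaf 75)) (node 11 (node 10 (node 16 (node 17 (leaf
  74) (leaf 71)) (leaf 71)) (leaf 69)) (node 17 (node 16 (leaf 72) (leaf 70)) (leaf 69)))) (node 9
  (node 16 (node 7 (node 11 (node 10 (leaf 75) (leaf 70)) (leaf 70)) (node 17 (leaf 75) (node 11
  (node 10 (leaf 69) (leaf 61)) (leaf 64)))) (node 11 (node 10 (leaf 69) (node 7 (leaf 69) (leaf
  62))) (leaf 62))) (node 16 (node 7 (leaf 71) (node 17 (leaf 71) (leaf 62))) (node 7 (leaf 66)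
  (leaf 62))))))) (node 7 (node 0 (node 10 (node 8 (node 11 (leaf 80) (leaf 79)) (node 1 (leaf 74)
  (leaf 73))) (node 8 (leaf 73) (leaf 69))) (node 1 (leaf 80) (node 11 (node 9 (node 8 (node 10
  (leaf 77) (leaf 73)) (node 10 (leaf 69) (leaf 65))) (node 8 (leaf 74) (leaf 67))) (node 8 (leaf
  68) (leaf 65))))) (node 1 (node 8 (leaf 78) (node 16 (node 17 (leaf 75) (leaf 68)) (leaf 68)))
  (node 0 (node 10 (node 8 (node 11 (leaf 76) (leaf 72)) (node 11 (node 16 (leaf 72) (leaf 71))
  (leaf 64))) (node 8 (leaf 69) (node 16 (node 17 (leaf 63) (leaf 60)) (leaf 60)))) (node 8 (node
  11 (node 10 (leaf 66) (leaf 65)) (leaf 64)) (node 16 (node 17 (leaf 63) (node 11 (node 9 (node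
  10 (leaf 60) (leaf 57)) (leaf 58)) (leaf 57))) (node 9 (node 11 (node 10 (leaf 60) (leaf 58))
  (leaf 58)) (leaf 58)))))))) (node 7 (node 0 (node 10 (node 4 (node 8 (node 11 (leaf 80) (leaf
  76)) (node 1 (leaf 74) (leaf 73))) (node 8 (node 11 (node 14 (node 13 (leaf 77) (leaf 73)) (node
  1 (leaf 73) (leaf 71))) (leaf 70)) (node 14 (node 1 (node 13 (leaf 74) (leaf 68)) (node 11 (node
  13 (leaf 71) (leaf 70)) (node 13 (leaf 69) (leaf 67)))) (leaf 67)))) (node 4 (leaf 73) (node 8
  (leaf 69) (leaf 65)))) (node 1 (node 4 (node 8 (leaf 82) (leaf 74)) (node 13 (node 14 (leaf 77)
  (node 8 (leaf 77) (leaf 68))) (leaf 73))) (node 4 (node 9 (node 10 (node 8 (leaf 75) (leaf 68))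
  (node 8 (leaf 73) (leaf 68))) (node 8 (leaf 73) (leaf 65))) (node 9 (node 11 (node 8 (node 10
  (leaf 69) (node 13 (node 14 (leaf 67) (leaf 62)) (leaf 62))) (node 14 (node 13 (leaf 66) (leaf
  58)) (leaf 58))) (node 8 (leaf 61) (leaf 58))) (node 14 (node 13 (node 8 (leaf 71) (leaf 63))
  (node 8 (leaf 61) (leaf 58))) (node 8 (leaf 62) (leaf 61))))))) (node 1 (node 8 (node 14 (node
  13 (leaf 76) (leaf 66)) (leaf 66)) (node 4 (node 17 (node 16 (leaf 74) (leaf 66)) (leaf 68))
  (node 13 (node 14 (node 16 (node 17 (leaf 67) (leaf 65)) (leaf 64)) (node 16 (node 17 (leaf 66)
  (leaf 60)) (leaf 60))) (node 17 (node 16 (leaf 65) (leaf 58)) (leaf 58))))) (node 0 (node 8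
  (node 10 (node 11 (node 13 (node 14 (leaf 74) (leaf 66)) (leaf 66)) (leaf 67)) (node 13 (node 14
  (leaf 65) (leaf 64)) (leaf 63))) (node 10 (node 4 (node 11 (node 17 (node 16 (leaf 72) (leaf
  71)) (leaf 68)) (leaf 63)) (node 11 (node 13 (node 14 (leaf 67) (node 17 (node 16 (leaf 66)
  (leaf 60)) (leaf 58))) (node 16 (node 17 (leaf 66) (leaf 57)) (leaf 57))) (node 14 (node 13
  (node 16 (leaf 64) (leaf 62)) (node 16 (node 17 (leaf 59) (leaf 53)) (leaf 53))) (node 17 (leaf
  59) (leaf 55))))) (node 13 (node 4 (node 16 (leaf 63) (leaf 62)) (node 14 (node 16 (node 17
  (leaf 62) (leaf 58)) (leaf 58)) (node 17 (leaf 57) (leaf 53)))) (node 17 (leaf 56) (leaf 54)))))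
  (node 13 (node 14 (node 17 (node 8 (node 11 (node 9 (leaf 66) (leaf 65)) (leaf 63)) (node 16
  (leaf 63) (node 9 (node 11 (node 10 (leaf 58) (leaf 57)) (leaf 56)) (leaf 56)))) (node 9 (node
  10 (node 11 (node 4 (leaf 59) (leaf 58)) (leaf 53)) (leaf 57)) (leaf 57))) (node 8 (node 11
  (node 9 (leaf 60) (leaf 58)) (leaf 57)) (node 16 (node 17 (leaf 59) (node 11 (node 9 (node 10
  (leaf 52) (leaf 50)) (leaf 50)) (leaf 49))) (leaf 52)))) (node 8 (node 9 (leaf 60) (leaf 58))
  (node 16 (node 17 (leaf 59) (node 10 (leaf 52) (leaf 49))) (node 9 (leaf 50) (leaf 49)))))))))
  (node 5 (node 9 (node 0 (node 10 (node 1 (node 7 (leaf 74) (node 8 (node 16 (node 15 (leaf 75)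
  (node 4 (leaf 73) (leaf 69))) (leaf 68)) (node 4 (node 17 (node 16 (node 15 (leaf 73) (leaf 69))
  (leaf 67)) (leaf 65)) (node 17 (node 15 (node 16 (leaf 68) (leaf 65)) (leaf 66)) (leaf 65)))))
  (node 8 (node 11 (node 16 (node 15 (leaf 74) (leaf 71)) (leaf 71)) (node 4 (node 16 (leaf 71)
  (leaf 70)) (node 7 (leaf 69) (leaf 67)))) (node 7 (leaf 72) (node 17 (node 4 (node 15 (node 16
  (leaf 70) (leaf 66)) (leaf 68)) (node 11 (leaf 71) (leaf 62))) (node 11 (leaf 65) (leaf 64))))))
  (node 7 (leaf 68) (node 8 (node 16 (node 15 (leaf 66) (leaf 62)) (leaf 60)) (node 4 (leaf 60)
  (leaf 58))))) (node 1 (node 17 (node 15 (node 7 (leaf 74) (node 8 (node 16 (leaf 74) (leaf 68))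
  (node 16 (node 4 (leaf 73) (leaf 68)) (leaf 66)))) (node 7 (leaf 74) (node 8 (leaf 73) (leaf
  68)))) (node 7 (leaf 74) (leaf 66))) (node 17 (node 4 (node 11 (node 10 (node 7 (leaf 71) (node
  8 (node 16 (leaf 70) (leaf 69)) (node 15 (node 16 (leaf 69) (leaf 62)) (leaf 62)))) (node 7
  (leaf 65) (node 8 (node 16 (leaf 65) (leaf 62)) (node 15 (leaf 60) (leaf 57))))) (node 7 (leaf
  64) (node 8 (node 16 (leaf 64) (leaf 62)) (node 15 (node 16 (leaf 59) (leaf 58)) (leaf 58)))))
  (node 7 (node 11 (node 10 (leaf 68) (leaf 65)) (leaf 65)) (node 8 (node 16 (node 15 (node 11
  (leaf 66) (leaf 64)) (node 11 (leaf 60) (leaf 58))) (node 11 (node 10 (leaf 60) (leaf 58)) (leaf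
  58))) (node 11 (node 10 (node 15 (leaf 60) (leaf 58)) (node 15 (leaf 58) (leaf 56))) (leaf
  56))))) (node 7 (leaf 72) (node 11 (node 4 (node 10 (leaf 61) (leaf 54)) (leaf 60)) (leaf
  54)))))) (node 1 (leaf 111) (node 7 (leaf 67) (node 8 (node 16 (node 15 (leaf 65) (node 4 (leaf
  62) (leaf 59))) (leaf 58)) (node 4 (node 17 (node 15 (leaf 60) (leaf 56)) (leaf 54)) (node 17
  (node 15 (node 16 (leaf 58) (leaf 57)) (leaf 56)) (leaf 54))))))) (node 0 (node 4 (node 7 (node
  10 (node 11 (node 14 (node 15 (leaf 72) (leaf 68)) (leaf 68)) (leaf 67)) (node 8 (leaf 69) (leaf
  62))) (node 8 (node 10 (node 11 (node 14 (node 15 (node 16 (leaf 72) (leaf 66)) (leaf 66)) (leaf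
  66)) (node 16 (leaf 67) (leaf 63))) (node 16 (node 15 (node 14 (leaf 65) (leaf 64)) (leaf 61))
  (leaf 62))) (node 10 (node 11 (node 15 (node 14 (leaf 66) (leaf 58)) (node 1 (leaf 60) (node 17
  (leaf 60) (leaf 58)))) (node 1 (leaf 59) (node 14 (node 15 (leaf 59) (leaf 54)) (leaf 55))))
  (node 15 (node 14 (leaf 57) (leaf 53)) (leaf 53))))) (node 15 (node 10 (node 11 (node 7 (node 13
  (node 14 (leaf 68) (leaf 65)) (leaf 65)) (node 13 (node 8 (node 16 (node 14 (leaf 66) (leaf 65))
  (leaf 60)) (node 14 (node 16 (node 17 (leaf 64) (node 1 (leaf 60) (leaf 58))) (leaf 60)) (node
  16 (node 17 (leaf 58) (leaf 55)) (leaf 57)))) (node 8 (node 16 (leaf 60) (leaf 57)) (node 1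
  (node 17 (leaf 58) (leaf 54)) (node 17 (node 16 (leaf 57) (leaf 56)) (leaf 54)))))) (node 7
  (node 13 (node 14 (leaf 67) (leaf 62)) (leaf 63)) (node 13 (node 8 (node 16 (leaf 61) (leaf 59))
  (node 1 (leaf 58) (node 14 (node 17 (leaf 58) (leaf 55)) (node 17 (leaf 54) (leaf 52))))) (node
  17 (node 8 (node 16 (leaf 55) (leaf 53)) (leaf 53)) (leaf 50))))) (node 13 (node 8 (node 14
  (node 16 (leaf 60) (leaf 58)) (leaf 57)) (node 7 (leaf 58) (node 14 (node 17 (leaf 57) (leaf
  53)) (leaf 52)))) (node 17 (node 7 (leaf 55) (node 8 (leaf 55) (leaf 53))) (node 7 (leaf 55)
  (leaf 49))))) (node 7 (node 10 (node 11 (leaf 66) (leaf 62)) (leaf 58)) (node 8 (node 11 (node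
  10 (node 14 (node 13 (leaf 63) (node 1 (leaf 62) (leaf 58))) (leaf 60)) (node 13 (leaf 57) (leaf
  53))) (node 1 (leaf 61) (leaf 59))) (node 1 (node 14 (leaf 56) (leaf 55)) (node 11 (node 10
  (node 14 (node 13 (leaf 54) (leaf 53)) (leaf 51)) (leaf 49)) (leaf 52))))))) (node 1 (node 13
  (node 7 (node 4 (node 14 (node 15 (leaf 72) (leaf 68)) (leaf 68)) (leaf 68)) (node 8 (node 4
  (node 14 (node 16 (node 15 (leaf 72) (leaf 66)) (leaf 66)) (leaf 66)) (node 15 (node 16 (leaf
  66) (leaf 60)) (node 14 (leaf 63) (leaf 60)))) (node 15 (node 4 (node 14 (node 17 (leaf 66)
  (leaf 63)) (leaf 60)) (node 17 (node 16 (node 14 (leaf 66) (leaf 60)) (leaf 60)) (node 14 (leaf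
  60) (leaf 58)))) (node 14 (node 4 (leaf 60) (leaf 56)) (leaf 51))))) (node 7 (leaf 71) (node 8
  (node 16 (leaf 60) (leaf 58)) (node 17 (node 16 (node 15 (leaf 58) (leaf 56)) (leaf 56)) (leaf
  54))))) (node 13 (node 15 (node 7 (node 4 (node 14 (node 9 (leaf 66) (leaf 65)) (node 8 (leaf
  60) (leaf 58))) (node 9 (node 11 (node 10 (node 14 (leaf 65) (node 8 (leaf 60) (leaf 58))) (node
  8 (leaf 60) (leaf 58))) (node 14 (leaf 54) (leaf 53))) (node 14 (leaf 61) (leaf 57)))) (node 8
  (node 4 (node 11 (node 16 (node 14 (leaf 65) (node 9 (leaf 60) (leaf 58))) (node 9 (node 10
  (leaf 58) (leaf 57)) (leaf 57))) (leaf 57)) (node 9 (node 11 (node 10 (node 16 (leaf 60) (leaf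
  57)) (node 14 (leaf 60) (node 16 (leaf 53) (leaf 52)))) (node 14 (leaf 54) (leaf 52))) (node 14
  (node 16 (leaf 58) (leaf 56)) (node 16 (leaf 55) (leaf 52))))) (node 4 (node 9 (node 14 (node 11
  (node 10 (leaf 58) (leaf 57)) (leaf 54)) (node 11 (node 10 (node 17 (leaf 57) (leaf 53)) (node
  17 (leaf 52) (leaf 50))) (leaf 49))) (node 14 (node 17 (leaf 56) (leaf 54)) (node 17 (leaf 52)
  (leaf 50)))) (node 16 (node 17 (node 9 (node 11 (node 10 (node 14 (leaf 58) (leaf 57)) (node 14
  (leaf 56) (leaf 52))) (leaf 52)) (node 14 (leaf 56) (leaf 52))) (node 9 (node 11 (node 10 (leaf
  52) (node 14 (leaf 50) (leaf 45))) (leaf 48)) (node 14 (leaf 50) (leaf 45)))) (node 11 (node 9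
  (leaf 52) (node 14 (leaf 52) (leaf 46))) (leaf 45)))))) (node 8 (node 9 (node 11 (node 14 (node
  10 (leaf 60) (node 4 (leaf 57) (leaf 56))) (node 10 (leaf 57) (node 7 (leaf 52) (leaf 51))))
  (node 7 (leaf 58) (leaf 50))) (node 14 (leaf 57) (node 7 (leaf 54) (leaf 50)))) (node 7 (node 11
  (node 9 (node 10 (leaf 58) (leaf 56)) (leaf 56)) (leaf 56)) (node 9 (node 11 (node 10 (node 14
  (leaf 52) (leaf 49)) (node 14 (node 4 (node 16 (leaf 50) (leaf 49)) (node 16 (leaf 47) (leaf
  45))) (leaf 44))) (node 14 (node 16 (leaf 47) (leaf 45)) (leaf 44))) (node 4 (node 16 (leaf 50)
  (leaf 49)) (node 16 (node 14 (leaf 49) (leaf 44)) (leaf 45))))))) (node 7 (leaf 54) (node 8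
  (node 16 (node 9 (node 15 (node 11 (leaf 54) (leaf 53)) (node 10 (leaf 53) (leaf 50))) (node 15
  (leaf 54) (leaf 50))) (leaf 49)) (node 9 (node 17 (node 15 (node 11 (node 16 (leaf 52) (leaf
  45)) (leaf 44)) (node 11 (leaf 46) (leaf 44))) (node 11 (leaf 47) (leaf 44))) (node 15 (node 16
  (node 17 (leaf 49) (leaf 47)) (leaf 44)) (leaf 44)))))))))) (node 6 (node 4 (node 8 (node 5
  (node 7 (node 9 (node 10 (node 11 (node 12 (node 0 (leaf 79) (node 1 (leaf 79) (leaf 77))) (leaf
  77)) (node 0 (leaf 77) (node 1 (leaf 77) (leaf 67)))) (node 12 (node 11 (leaf 73) (leaf 67))
  (leaf 67))) (node 1 (leaf 80) (node 11 (node 12 (leaf 73) (leaf 68)) (leaf 67)))) (node 0 (node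
  12 (node 11 (node 10 (leaf 78) (leaf 70)) (leaf 70)) (node 1 (leaf 72) (leaf 71))) (node 1 (node
  11 (node 12 (leaf 77) (leaf 72)) (leaf 71)) (node 9 (node 10 (node 11 (leaf 70) (leaf 64)) (node
  12 (node 11 (leaf 66) (leaf 64)) (leaf 64))) (node 12 (node 11 (leaf 67) (leaf 64)) (leaf
  64)))))) (node 9 (node 10 (node 12 (node 0 (node 11 (leaf 76) (node 1 (leaf 76) (node 7 (leaf
  71) (leaf 66)))) (node 1 (node 11 (leaf 76) (node 7 (leaf 73) (leaf 66))) (node 7 (node 11 (leaf
  75) (leaf 63)) (leaf 66)))) (node 7 (leaf 73) (leaf 66))) (node 12 (node 11 (node 7 (leaf 70)
  (leaf 66)) (node 7 (leaf 62) (leaf 60))) (node 7 (leaf 62) (leaf 60)))) (node 1 (leaf 81) (node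
  12 (node 11 (node 7 (leaf 70) (leaf 65)) (node 7 (leaf 62) (leaf 60))) (node 7 (leaf 61) (leaf
  58)))))) (node 5 (node 1 (node 12 (node 11 (node 7 (leaf 75) (node 17 (node 16 (leaf 74) (leaf
  69)) (leaf 69))) (node 16 (node 7 (leaf 70) (node 17 (leaf 71) (leaf 64))) (node 7 (leaf 71)
  (leaf 62)))) (node 7 (leaf 71) (node 17 (node 16 (leaf 71) (leaf 65)) (node 0 (leaf 64) (leaf
  62))))) (node 0 (node 7 (node 12 (node 11 (node 10 (leaf 75) (leaf 72)) (leaf 70)) (leaf 70))
  (node 12 (node 10 (node 11 (node 17 (node 16 (leaf 71) (leaf 70)) (leaf 69)) (node 16 (node 17
  (leaf 71) (leaf 61)) (leaf 62))) (node 16 (leaf 64) (leaf 62))) (node 16 (node 17 (leaf 71)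
  (leaf 64)) (leaf 62)))) (node 7 (node 11 (node 9 (node 10 (leaf 70) (node 12 (leaf 69) (leaf
  64))) (node 12 (leaf 69) (leaf 62))) (leaf 62)) (node 9 (node 10 (node 16 (node 17 (leaf 71)
  (node 11 (leaf 64) (leaf 54))) (node 11 (leaf 62) (leaf 56))) (node 12 (node 11 (node 16 (leaf
  65) (leaf 62)) (node 16 (node 17 (leaf 65) (leaf 52)) (leaf 53))) (node 16 (node 17 (leaf 63)
  (leaf 53)) (leaf 55)))) (node 12 (node 11 (node 16 (node 17 (leaf 62) (leaf 59)) (leaf 59))
  (node 16 (node 17 (leaf 61) (leaf 53)) (leaf 55))) (node 16 (node 17 (leaf 59) (leaf 53)) (leaf
  55))))))) (node 7 (node 9 (node 11 (node 12 (node 1 (leaf 74) (node 0 (node 10 (leaf 73) (leaf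
  66)) (leaf 66))) (node 1 (leaf 66) (node 0 (leaf 65) (leaf 58)))) (node 0 (leaf 68) (node 1
  (leaf 68) (leaf 58)))) (node 1 (leaf 81) (node 11 (node 12 (leaf 63) (leaf 58)) (leaf 58))))
  (node 0 (node 17 (node 12 (node 10 (node 1 (node 11 (leaf 66) (leaf 63)) (node 16 (leaf 66)
  (node 11 (leaf 63) (leaf 57)))) (node 16 (leaf 66) (leaf 58))) (node 16 (leaf 66) (leaf 57)))
  (node 12 (node 10 (node 11 (leaf 65) (node 1 (leaf 60) (leaf 57))) (leaf 59)) (leaf 57))) (node
  1 (node 17 (node 11 (node 12 (leaf 66) (node 16 (leaf 66) (leaf 58))) (node 16 (leaf 66) (leaf
  58))) (node 12 (node 11 (leaf 65) (leaf 59)) (leaf 58))) (node 12 (node 9 (node 10 (node 17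
  (node 16 (leaf 67) (leaf 58)) (leaf 59)) (node 11 (leaf 59) (node 17 (node 16 (leaf 54) (leaf
  52)) (leaf 49)))) (node 17 (node 11 (node 16 (leaf 58) (leaf 56)) (node 16 (leaf 56) (leaf 52)))
  (node 11 (leaf 54) (leaf 52)))) (node 16 (node 17 (leaf 68) (leaf 52)) (node 9 (leaf 50) (leaf
  49))))))))) (node 7 (node 5 (node 0 (node 10 (node 8 (node 11 (node 12 (node 13 (leaf 77) (leaf
  73)) (leaf 73)) (node 1 (leaf 78) (node 12 (node 13 (leaf 71) (leaf 70)) (leaf 67)))) (node 1
  (node 12 (node 13 (leaf 71) (leaf 68)) (leaf 68)) (node 11 (node 12 (leaf 69) (leaf 67)) (leaf
  65)))) (node 8 (leaf 67) (leaf 64))) (node 1 (node 11 (node 12 (node 8 (node 13 (leaf 77) (leaf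
  75)) (leaf 71)) (node 8 (leaf 70) (leaf 68))) (node 8 (leaf 73) (leaf 65))) (node 9 (node 10
  (node 12 (node 8 (node 13 (leaf 73) (node 11 (leaf 70) (leaf 61))) (node 11 (leaf 65) (leaf
  58))) (node 11 (node 8 (leaf 67) (leaf 64)) (node 8 (leaf 61) (leaf 54)))) (node 11 (node 12
  (node 13 (node 8 (leaf 67) (leaf 64)) (node 8 (leaf 61) (leaf 58))) (node 8 (leaf 62) (leaf
  58))) (node 8 (leaf 62) (leaf 56)))) (node 11 (node 13 (node 12 (node 8 (leaf 68) (leaf 62))
  (node 8 (leaf 61) (leaf 56))) (node 8 (leaf 61) (leaf 58))) (node 8 (leaf 62) (leaf 56))))))
  (node 0 (node 10 (node 12 (node 8 (node 11 (node 14 (node 13 (leaf 73) (node 1 (leaf 65) (leaf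
  64))) (leaf 69)) (node 14 (node 13 (leaf 67) (leaf 62)) (leaf 62))) (node 1 (node 14 (leaf 66)
  (leaf 65)) (node 11 (node 13 (leaf 65) (leaf 62)) (node 14 (node 13 (leaf 62) (leaf 58)) (leaf
  58))))) (node 14 (node 13 (node 11 (leaf 68) (node 8 (leaf 66) (leaf 58))) (node 8 (leaf 61)
  (leaf 58))) (node 8 (leaf 62) (leaf 58)))) (node 8 (node 13 (leaf 62) (leaf 61)) (leaf 58)))
  (node 1 (node 12 (node 8 (node 11 (node 13 (leaf 73) (leaf 71)) (node 14 (node 13 (leaf 66)
  (leaf 61)) (leaf 62))) (node 11 (leaf 66) (node 13 (node 14 (leaf 62) (leaf 58)) (leaf 58))))
  (node 14 (node 13 (leaf 66) (node 8 (leaf 60) (leaf 58))) (node 8 (leaf 62) (leaf 58)))) (node 9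
  (node 10 (node 12 (node 14 (node 13 (node 11 (node 8 (leaf 66) (leaf 63)) (node 8 (leaf 61)
  (leaf 58))) (node 8 (node 11 (leaf 61) (leaf 58)) (node 11 (leaf 58) (leaf 53)))) (node 8 (node
  11 (leaf 62) (leaf 56)) (node 11 (leaf 57) (leaf 54)))) (node 8 (node 11 (leaf 62) (leaf 58))
  (node 11 (leaf 58) (leaf 56)))) (node 13 (node 11 (node 14 (node 8 (leaf 62) (leaf 58)) (node 12
  (leaf 60) (node 8 (leaf 55) (leaf 52)))) (node 8 (node 14 (leaf 61) (leaf 53)) (node 14 (leaf
  56) (leaf 50)))) (node 8 (leaf 53) (node 12 (node 11 (leaf 52) (leaf 50)) (leaf 50))))) (node 12
  (node 8 (node 14 (node 13 (leaf 61) (leaf 55)) (node 11 (leaf 59) (leaf 55))) (node 11 (node 13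
  (node 14 (leaf 58) (leaf 54)) (leaf 54)) (node 13 (node 14 (leaf 57) (leaf 52)) (leaf 52))))
  (node 8 (node 14 (node 13 (leaf 58) (leaf 53)) (leaf 55)) (node 14 (node 13 (leaf 56) (leaf 52))
  (leaf 52)))))))) (node 1 (node 12 (node 5 (node 11 (node 13 (node 16 (node 17 (leaf 70) (leaf
  62)) (leaf 65)) (node 8 (leaf 65) (leaf 58))) (node 17 (node 16 (leaf 64) (leaf 58)) (leaf 57)))
  (node 11 (node 16 (node 17 (node 14 (leaf 66) (leaf 65)) (node 13 (node 14 (leaf 58) (leaf 54))
  (leaf 54))) (node 13 (leaf 57) (leaf 56))) (node 8 (node 14 (node 13 (leaf 63) (node 0 (leaf 62)
  (leaf 60))) (leaf 57)) (node 13 (node 14 (node 16 (node 17 (leaf 61) (leaf 53)) (leaf 56)) (node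
  17 (node 16 (leaf 54) (leaf 52)) (leaf 49))) (node 16 (node 17 (leaf 58) (leaf 52)) (node 0
  (leaf 53) (leaf 52))))))) (node 13 (node 14 (node 5 (node 16 (node 17 (leaf 63) (node 0 (leaf
  58) (leaf 57))) (leaf 58)) (node 8 (leaf 63) (node 17 (node 16 (leaf 61) (leaf 56)) (leaf 54))))
  (node 16 (node 17 (leaf 61) (leaf 52)) (leaf 54))) (node 8 (leaf 60) (node 0 (node 17 (node 16
  (leaf 58) (leaf 53)) (leaf 52)) (node 17 (node 16 (leaf 53) (leaf 52)) (leaf 52)))))) (node 9
  (node 16 (node 17 (node 10 (node 0 (node 11 (node 12 (leaf 66) (node 14 (node 13 (leaf 63) (leaf
  60)) (leaf 60))) (node 14 (node 13 (node 12 (leaf 63) (leaf 60)) (leaf 62)) (leaf 58))) (node 14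
  (node 11 (node 13 (node 12 (leaf 63) (leaf 60)) (leaf 60)) (node 12 (leaf 56) (node 5 (leaf 55)
  (leaf 51)))) (node 11 (leaf 57) (leaf 50)))) (node 13 (node 14 (node 12 (node 11 (leaf 60) (node
  5 (leaf 56) (leaf 54))) (leaf 57)) (leaf 50)) (leaf 50))) (node 0 (node 10 (node 5 (node 11
  (node 13 (leaf 58) (leaf 57)) (node 12 (node 13 (leaf 57) (leaf 53)) (leaf 53))) (node 12 (node
  11 (node 13 (node 14 (leaf 57) (leaf 55)) (leaf 53)) (node 14 (leaf 52) (leaf 50))) (node 13
  (node 14 (node 11 (leaf 53) (leaf 52)) (leaf 52)) (leaf 52)))) (leaf 49)) (node 5 (node 10 (node
  12 (node 13 (leaf 57) (leaf 52)) (node 11 (leaf 53) (leaf 48))) (node 12 (node 11 (leaf 49)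
  (leaf 47)) (leaf 47))) (node 10 (node 14 (node 12 (node 13 (node 11 (leaf 53) (leaf 52)) (node
  11 (leaf 52) (leaf 45))) (node 11 (leaf 52) (leaf 45))) (node 11 (leaf 47) (leaf 45))) (node 13
  (node 14 (node 11 (leaf 49) (leaf 47)) (node 11 (leaf 43) (leaf 41))) (node 12 (leaf 43) (leaf
  42))))))) (node 0 (node 10 (node 5 (node 11 (node 12 (node 13 (leaf 60) (leaf 57)) (leaf 58))
  (node 13 (leaf 55) (leaf 53))) (node 12 (node 11 (node 13 (leaf 57) (leaf 53)) (node 14 (leaf
  53) (leaf 52))) (node 13 (node 11 (node 14 (leaf 53) (leaf 52)) (leaf 52)) (leaf 49)))) (leaf
  52)) (node 12 (node 10 (node 14 (node 13 (node 11 (leaf 56) (leaf 52)) (node 11 (leaf 52) (leaf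
  45))) (leaf 45)) (node 5 (leaf 49) (node 11 (node 13 (leaf 48) (leaf 45)) (node 13 (node 14
  (leaf 45) (leaf 44)) (leaf 43))))) (node 10 (node 11 (leaf 52) (node 5 (leaf 45) (leaf 41)))
  (node 13 (node 14 (leaf 45) (leaf 44)) (node 5 (leaf 46) (leaf 42))))))) (node 16 (node 17 (node
  13 (node 14 (node 12 (node 11 (leaf 58) (leaf 56)) (leaf 56)) (leaf 50)) (node 12 (leaf 52)
  (leaf 50))) (node 13 (node 14 (node 11 (node 12 (leaf 52) (leaf 47)) (leaf 47)) (leaf 44)) (node
  5 (leaf 46) (leaf 42)))) (node 12 (node 5 (node 13 (leaf 52) (leaf 49)) (node 11 (node 13 (node
  14 (leaf 48) (leaf 45)) (leaf 45)) (node 13 (node 14 (leaf 45) (leaf 44)) (leaf 42)))) (node 13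
  (node 14 (leaf 45) (leaf 42)) (leaf 42)))))))) (node 4 (node 5 (node 7 (node 1 (node 11 (node 12
  (leaf 74) (leaf 70)) (leaf 68)) (node 0 (node 12 (node 10 (node 11 (leaf 72) (leaf 68)) (leaf
  66)) (leaf 68)) (node 12 (node 11 (node 9 (leaf 66) (node 8 (leaf 65) (leaf 63))) (node 8 (node
  9 (leaf 60) (leaf 58)) (leaf 58))) (node 9 (leaf 60) (leaf 58))))) (node 8 (node 12 (node 0
  (node 10 (node 11 (node 16 (node 15 (leaf 72) (leaf 71)) (leaf 69)) (node 16 (leaf 66) (leaf
  62))) (node 16 (leaf 65) (leaf 62))) (node 1 (node 11 (leaf 72) (node 16 (leaf 66) (leaf 62)))
  (node 11 (node 16 (node 15 (leaf 66) (leaf 62)) (leaf 59)) (node 16 (node 9 (node 15 (leaf 60)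
  (leaf 56)) (node 15 (leaf 59) (leaf 54))) (leaf 53))))) (node 0 (node 16 (leaf 65) (leaf 62))
  (node 1 (leaf 65) (node 9 (node 10 (leaf 63) (leaf 54)) (leaf 54))))) (node 12 (node 1 (node 11
  (node 17 (node 16 (leaf 66) (leaf 62)) (leaf 65)) (node 17 (leaf 58) (node 0 (leaf 57) (leaf
  56)))) (node 0 (node 11 (node 10 (leaf 66) (leaf 56)) (node 16 (node 17 (leaf 58) (leaf 57))
  (leaf 57))) (node 11 (node 17 (node 9 (leaf 58) (leaf 56)) (node 9 (leaf 56) (leaf 54))) (node
  17 (node 16 (leaf 52) (leaf 50)) (node 10 (leaf 50) (leaf 49)))))) (node 0 (node 15 (leaf 58)
  (leaf 57)) (node 1 (leaf 58) (node 9 (node 10 (leaf 55) (node 17 (node 16 (leaf 52) (leaf 50))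
  (leaf 50))) (node 17 (node 16 (leaf 52) (leaf 51)) (leaf 50)))))))) (node 7 (node 9 (node 10
  (node 12 (node 0 (node 11 (node 14 (node 15 (leaf 69) (leaf 66)) (leaf 65)) (node 14 (node 15
  (leaf 65) (node 8 (leaf 61) (leaf 58))) (leaf 58))) (node 1 (node 11 (leaf 69) (node 14 (node 15
  (leaf 65) (node 8 (leaf 62) (leaf 58))) (leaf 58))) (node 15 (node 14 (leaf 66) (node 11 (leaf
  56) (leaf 54))) (node 8 (node 11 (leaf 62) (leaf 56)) (node 11 (leaf 58) (leaf 57)))))) (node 14
  (node 15 (leaf 65) (leaf 57)) (leaf 58))) (node 12 (node 8 (node 11 (leaf 61) (leaf 53)) (node
  11 (node 15 (node 14 (leaf 59) (leaf 58)) (leaf 58)) (node 14 (node 15 (leaf 53) (leaf 52))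
  (leaf 50)))) (node 14 (node 15 (leaf 54) (leaf 52)) (leaf 52)))) (node 1 (leaf 72) (node 11
  (node 12 (node 14 (node 15 (leaf 61) (leaf 56)) (leaf 54)) (node 14 (node 15 (leaf 54) (leaf
  52)) (leaf 52))) (node 14 (node 15 (leaf 54) (leaf 52)) (leaf 52))))) (node 12 (node 0 (node 10
  (node 11 (node 8 (node 16 (node 14 (node 15 (leaf 67) (leaf 62)) (leaf 65)) (leaf 63)) (node 14
  (node 15 (node 1 (leaf 66) (leaf 63)) (node 17 (leaf 58) (leaf 54))) (node 17 (leaf 57) (leaf
  54)))) (node 14 (node 8 (node 16 (node 15 (leaf 65) (leaf 60)) (leaf 57)) (node 15 (node 1 (leaf
  58) (node 17 (leaf 57) (leaf 54))) (leaf 50))) (node 8 (leaf 58) (node 17 (leaf 52) (leaf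
  50))))) (node 8 (node 16 (node 14 (node 15 (leaf 61) (leaf 60)) (leaf 57)) (leaf 58)) (node 14
  (node 15 (node 17 (leaf 58) (leaf 54)) (leaf 50)) (leaf 49)))) (node 1 (node 11 (leaf 67) (node
  8 (node 14 (node 16 (node 15 (leaf 62) (leaf 60)) (leaf 58)) (leaf 57)) (node 14 (node 15 (node
  17 (leaf 58) (leaf 54)) (leaf 50)) (node 17 (leaf 52) (leaf 49))))) (node 8 (node 9 (node 10
  (node 14 (node 16 (node 15 (node 11 (leaf 65) (leaf 56)) (node 11 (leaf 60) (leaf 53))) (leaf
  58)) (node 11 (leaf 57) (leaf 50))) (node 11 (leaf 62) (node 15 (node 14 (node 16 (leaf 53)
  (leaf 52)) (leaf 50)) (leaf 51)))) (node 11 (node 14 (node 15 (node 16 (leaf 62) (leaf 56))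
  (leaf 56)) (leaf 54)) (node 14 (node 15 (node 16 (leaf 54) (leaf 52)) (leaf 50)) (leaf 50))))
  (node 11 (node 14 (node 15 (node 9 (node 17 (leaf 58) (leaf 54)) (leaf 56)) (node 9 (node 10
  (leaf 50) (node 16 (leaf 49) (leaf 45))) (node 16 (leaf 47) (leaf 45)))) (node 17 (node 9 (leaf
  52) (node 16 (leaf 48) (leaf 45))) (node 9 (leaf 49) (leaf 47)))) (node 14 (node 15 (node 17
  (leaf 52) (leaf 47)) (leaf 44)) (node 10 (leaf 44) (node 17 (leaf 43) (leaf 41)))))))) (node 8
  (node 9 (node 10 (node 14 (node 16 (node 15 (leaf 65) (leaf 59)) (leaf 57)) (leaf 60)) (node 14
  (node 16 (node 15 (leaf 54) (leaf 51)) (leaf 52)) (leaf 50))) (node 1 (leaf 68) (node 14 (node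
  16 (node 15 (leaf 54) (leaf 50)) (leaf 49)) (leaf 50)))) (node 1 (node 14 (node 15 (node 17
  (leaf 57) (leaf 54)) (leaf 50)) (node 17 (leaf 54) (leaf 52))) (node 0 (node 14 (node 15 (node
  17 (leaf 56) (leaf 54)) (leaf 50)) (leaf 52)) (node 9 (node 10 (leaf 55) (node 14 (node 15 (node
  17 (leaf 49) (leaf 47)) (leaf 44)) (leaf 44))) (node 14 (node 15 (node 17 (leaf 49) (leaf 47))
  (node 16 (leaf 44) (leaf 41))) (leaf 42))))))))) (node 1 (node 5 (node 7 (node 11 (node 13 (node
  12 (leaf 70) (node 0 (leaf 67) (leaf 65))) (leaf 65)) (leaf 65)) (node 17 (node 8 (node 13 (node
  11 (node 16 (node 12 (leaf 66) (node 15 (leaf 64) (leaf 60))) (node 12 (leaf 61) (leaf 58)))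
  (node 16 (node 15 (leaf 63) (leaf 58)) (leaf 58))) (node 15 (node 16 (leaf 65) (leaf 58)) (leaf
  60))) (node 13 (node 11 (node 12 (node 16 (node 15 (leaf 65) (leaf 58)) (leaf 60)) (node 15
  (leaf 58) (leaf 56))) (node 15 (node 16 (leaf 58) (leaf 56)) (leaf 56))) (leaf 56))) (node 13
  (node 12 (node 11 (leaf 61) (node 0 (leaf 57) (leaf 54))) (leaf 54)) (leaf 54)))) (node 13 (node
  7 (node 11 (node 14 (node 12 (node 15 (leaf 65) (node 8 (leaf 61) (leaf 58))) (node 8 (leaf 60)
  (node 15 (leaf 58) (leaf 56)))) (node 12 (node 8 (leaf 60) (leaf 58)) (node 8 (leaf 56) (leaf
  54)))) (node 15 (node 14 (leaf 58) (leaf 53)) (leaf 56))) (node 8 (node 12 (node 11 (node 14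
  (node 16 (node 15 (leaf 65) (leaf 60)) (leaf 58)) (node 15 (node 16 (leaf 60) (leaf 57)) (leaf
  58))) (node 15 (node 0 (leaf 58) (node 14 (node 16 (leaf 57) (leaf 56)) (node 16 (leaf 54) (leaf
  52)))) (leaf 50))) (node 16 (node 14 (node 15 (leaf 60) (leaf 53)) (node 15 (leaf 55) (leaf
  50))) (leaf 54))) (node 11 (node 16 (node 17 (node 12 (node 15 (node 14 (leaf 58) (leaf 57))
  (leaf 52)) (node 14 (node 15 (leaf 56) (leaf 53)) (node 15 (leaf 54) (leaf 45)))) (node 14 (node
  15 (node 12 (leaf 54) (leaf 52)) (node 12 (leaf 52) (node 0 (leaf 47) (leaf 45)))) (node 12
  (leaf 52) (node 0 (leaf 47) (leaf 46))))) (node 14 (node 12 (node 15 (leaf 56) (leaf 50)) (node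
  15 (leaf 54) (leaf 45))) (node 12 (leaf 53) (leaf 51)))) (node 15 (node 17 (node 16 (node 14
  (leaf 53) (leaf 52)) (node 0 (leaf 53) (node 14 (leaf 49) (leaf 45)))) (node 0 (leaf 50) (node
  14 (leaf 49) (leaf 48)))) (node 0 (leaf 47) (leaf 44)))))) (node 12 (node 14 (node 11 (node 7
  (leaf 56) (node 8 (leaf 56) (node 15 (leaf 56) (node 16 (leaf 47) (leaf 45))))) (node 17 (node 7
  (leaf 54) (node 8 (node 16 (node 0 (leaf 55) (leaf 53)) (leaf 52)) (node 0 (leaf 53) (node 16
  (node 15 (leaf 52) (leaf 44)) (leaf 44))))) (node 7 (leaf 55) (node 0 (leaf 49) (leaf 44)))))
  (node 7 (leaf 54) (node 8 (leaf 54) (node 17 (node 16 (leaf 48) (leaf 45)) (node 0 (leaf 47)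
  (leaf 45)))))) (node 17 (node 7 (leaf 54) (node 8 (node 15 (node 16 (leaf 53) (leaf 52)) (leaf
  50)) (node 16 (node 15 (leaf 52) (leaf 44)) (leaf 43)))) (node 7 (leaf 54) (leaf 44)))))) (node
  13 (node 9 (node 0 (node 10 (node 5 (node 7 (node 11 (node 12 (leaf 68) (leaf 67)) (node 12
  (leaf 65) (node 8 (leaf 60) (leaf 58)))) (node 8 (node 12 (node 16 (node 15 (leaf 66) (node 11
  (leaf 63) (leaf 58))) (node 11 (leaf 62) (leaf 58))) (node 11 (node 16 (node 15 (leaf 62) (leaf
  60)) (leaf 58)) (node 16 (node 15 (leaf 60) (leaf 55)) (leaf 55)))) (node 11 (node 12 (node 17
  (node 15 (leaf 60) (leaf 57)) (leaf 58)) (node 17 (node 15 (leaf 58) (leaf 53)) (leaf 54)))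
  (node 12 (node 17 (node 15 (node 16 (leaf 58) (leaf 56)) (leaf 56)) (leaf 57)) (node 17 (node 15
  (node 16 (leaf 55) (leaf 50)) (leaf 52)) (leaf 50)))))) (node 7 (node 11 (node 12 (node 14 (node
  15 (leaf 65) (node 8 (leaf 58) (leaf 57))) (node 8 (leaf 61) (leaf 58))) (node 15 (node 14 (node
  8 (leaf 60) (leaf 58)) (leaf 59)) (leaf 53))) (node 12 (node 15 (node 14 (leaf 58) (leaf 53))
  (leaf 56)) (node 14 (node 15 (leaf 55) (leaf 52)) (leaf 52)))) (node 8 (node 12 (node 11 (node
  14 (node 15 (node 16 (leaf 65) (leaf 57)) (leaf 58)) (node 15 (node 16 (leaf 60) (leaf 59))
  (leaf 59))) (node 15 (node 14 (node 16 (leaf 58) (leaf 53)) (node 16 (leaf 53) (leaf 52))) (leaf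
  50))) (node 14 (node 11 (node 15 (node 16 (leaf 60) (leaf 55)) (leaf 56)) (node 16 (node 15
  (leaf 55) (leaf 50)) (leaf 52))) (node 15 (node 11 (node 16 (leaf 54) (leaf 52)) (leaf 50))
  (leaf 50)))) (node 14 (node 12 (node 15 (node 11 (node 17 (node 16 (leaf 57) (leaf 56)) (leaf
  54)) (node 17 (node 16 (leaf 53) (leaf 52)) (leaf 50))) (node 16 (node 11 (leaf 52) (leaf 46))
  (node 11 (leaf 50) (leaf 45)))) (node 15 (node 17 (node 11 (node 16 (leaf 53) (leaf 52)) (leaf
  52)) (node 11 (leaf 52) (leaf 48))) (node 11 (node 16 (leaf 49) (leaf 45)) (node 17 (leaf 44)
  (leaf 42))))) (node 11 (node 17 (node 15 (node 16 (node 12 (leaf 54) (leaf 52)) (leaf 52)) (node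
  12 (leaf 54) (leaf 44))) (node 12 (leaf 52) (leaf 48))) (node 12 (node 17 (node 15 (node 16
  (leaf 52) (leaf 45)) (leaf 44)) (leaf 44)) (node 17 (node 16 (leaf 49) (leaf 44)) (leaf
  42)))))))) (node 5 (node 8 (node 12 (node 16 (node 15 (leaf 62) (leaf 57)) (leaf 58)) (node 7
  (leaf 59) (leaf 54))) (node 7 (leaf 68) (node 17 (node 16 (leaf 52) (leaf 50)) (leaf 50))))
  (node 17 (node 12 (node 14 (node 15 (node 7 (leaf 55) (node 8 (leaf 55) (leaf 52))) (node 7
  (leaf 53) (node 8 (leaf 53) (node 16 (leaf 48) (leaf 45))))) (node 15 (leaf 50) (node 7 (leaf
  50) (node 8 (leaf 50) (leaf 44))))) (node 7 (leaf 52) (node 8 (leaf 50) (node 15 (node 14 (leaf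
  45) (leaf 44)) (leaf 44))))) (node 7 (leaf 55) (node 12 (leaf 47) (leaf 44)))))) (node 11 (node
  5 (node 12 (node 10 (node 7 (leaf 65) (node 8 (node 16 (node 15 (leaf 63) (leaf 57)) (leaf 58))
  (node 17 (node 15 (node 16 (leaf 58) (leaf 56)) (leaf 56)) (leaf 54)))) (node 8 (node 16 (node
  15 (leaf 60) (leaf 54)) (leaf 55)) (node 7 (leaf 68) (node 17 (node 16 (leaf 52) (leaf 50))
  (leaf 50))))) (node 7 (leaf 60) (node 8 (node 16 (node 10 (node 15 (leaf 60) (leaf 54)) (node 15
  (leaf 56) (leaf 52))) (leaf 52)) (node 17 (node 10 (node 16 (node 15 (leaf 55) (leaf 52)) (leaf
  50)) (node 16 (node 15 (leaf 52) (leaf 45)) (leaf 49))) (node 10 (leaf 50) (leaf 48)))))) (node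
  12 (node 17 (node 10 (node 16 (node 14 (node 7 (node 15 (leaf 58) (leaf 56)) (node 8 (node 15
  (leaf 57) (leaf 53)) (node 15 (leaf 56) (leaf 52)))) (node 15 (node 7 (leaf 53) (node 8 (leaf
  53) (leaf 52))) (node 7 (leaf 55) (node 8 (leaf 50) (leaf 44))))) (node 15 (node 14 (leaf 49)
  (leaf 45)) (leaf 45))) (node 16 (node 14 (node 7 (node 15 (leaf 54) (leaf 52)) (node 8 (node 15
  (leaf 54) (leaf 50)) (node 15 (leaf 52) (leaf 46)))) (leaf 50)) (node 15 (node 14 (leaf 45)
  (leaf 44)) (leaf 44)))) (node 7 (leaf 55) (node 10 (node 15 (node 14 (leaf 49) (leaf 47)) (leaf
  47)) (node 14 (node 15 (leaf 47) (leaf 46)) (leaf 44))))) (node 16 (node 17 (node 10 (node 7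
  (node 15 (node 14 (leaf 55) (leaf 52)) (leaf 52)) (node 14 (node 8 (node 15 (leaf 54) (leaf 51))
  (node 15 (leaf 52) (leaf 47))) (leaf 50))) (node 7 (node 15 (node 14 (leaf 52) (leaf 50)) (leaf
  45)) (node 8 (node 15 (node 14 (leaf 50) (leaf 49)) (leaf 44)) (node 15 (node 14 (leaf 45) (leaf
  44)) (leaf 38))))) (node 7 (leaf 55) (node 10 (node 14 (leaf 45) (leaf 44)) (node 15 (node 14
  (leaf 44) (leaf 39)) (leaf 36))))) (node 15 (node 14 (node 10 (leaf 45) (leaf 44)) (leaf 44))
  (node 10 (leaf 44) (leaf 38)))))) (node 5 (node 7 (node 12 (leaf 56) (leaf 53)) (node 8 (node 10
  (node 12 (leaf 58) (node 16 (leaf 50) (leaf 49))) (node 15 (node 16 (leaf 54) (leaf 52)) (leaf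
  51))) (node 12 (node 17 (node 15 (node 10 (leaf 52) (node 16 (leaf 50) (leaf 45))) (leaf 45))
  (leaf 47)) (node 17 (node 16 (node 15 (leaf 48) (leaf 41)) (leaf 44)) (leaf 44))))) (node 7
  (node 12 (node 14 (node 10 (leaf 52) (node 15 (leaf 50) (leaf 45))) (leaf 47)) (node 14 (node 15
  (leaf 48) (node 8 (leaf 45) (leaf 41))) (leaf 45))) (node 15 (node 14 (node 8 (node 12 (node 16
  (leaf 50) (leaf 45)) (node 16 (leaf 49) (leaf 41))) (node 17 (node 16 (node 12 (leaf 45) (leaf
  41)) (leaf 44)) (node 10 (node 12 (leaf 44) (leaf 40)) (leaf 41)))) (node 12 (node 16 (node 17
  (node 8 (leaf 47) (leaf 44)) (node 10 (leaf 36) (leaf 35))) (leaf 38)) (node 8 (leaf 44) (node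
  17 (leaf 38) (leaf 36))))) (node 8 (leaf 44) (node 10 (leaf 36) (node 17 (leaf 36) (leaf
  35))))))))) (node 5 (node 7 (node 11 (node 12 (leaf 58) (leaf 56)) (leaf 57)) (node 8 (node 16
  (node 15 (leaf 58) (leaf 50)) (leaf 52)) (node 17 (node 15 (node 16 (leaf 52) (node 11 (node 12
  (leaf 51) (leaf 45)) (leaf 45))) (leaf 44)) (node 11 (node 12 (leaf 50) (leaf 45)) (leaf 47)))))
  (node 7 (node 11 (node 12 (node 14 (node 15 (leaf 54) (leaf 52)) (leaf 52)) (node 14 (node 15
  (leaf 52) (leaf 44)) (node 8 (leaf 47) (leaf 45)))) (node 15 (node 14 (leaf 52) (node 8 (leaf
  47) (leaf 45))) (leaf 45))) (node 8 (node 16 (node 14 (node 12 (node 15 (node 11 (leaf 54) (leaf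
  50)) (node 11 (leaf 50) (leaf 45))) (node 15 (leaf 50) (leaf 44))) (node 15 (node 11 (node 12
  (leaf 50) (leaf 47)) (leaf 47)) (node 11 (node 12 (leaf 47) (leaf 42)) (leaf 42)))) (node 12
  (leaf 44) (leaf 42))) (node 15 (node 14 (node 12 (node 11 (node 16 (node 17 (leaf 49) (leaf 47))
  (leaf 44)) (node 17 (node 16 (leaf 45) (leaf 44)) (leaf 44))) (node 16 (leaf 44) (leaf 42)))
  (node 17 (node 16 (node 12 (node 11 (leaf 45) (leaf 44)) (leaf 42)) (node 11 (node 12 (leaf 42)
  (leaf 38)) (leaf 38))) (node 11 (node 12 (leaf 42) (leaf 36)) (leaf 36)))) (node 11 (node 12
  (node 16 (node 14 (leaf 44) (leaf 40)) (leaf 41)) (leaf 36)) (leaf 36))))))) (node 8 (node 9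
  (node 5 (node 0 (node 10 (node 11 (node 16 (node 15 (leaf 63) (leaf 58)) (leaf 57)) (node 16
  (leaf 59) (leaf 53))) (leaf 53)) (node 16 (node 15 (node 10 (node 11 (leaf 58) (leaf 53)) (leaf
  54)) (node 10 (leaf 53) (leaf 50))) (leaf 52))) (node 14 (node 16 (node 10 (node 12 (node 0
  (node 11 (leaf 54) (node 15 (leaf 54) (leaf 53))) (node 7 (node 15 (leaf 54) (leaf 53)) (node 11
  (leaf 53) (node 15 (leaf 49) (leaf 44))))) (node 15 (node 7 (leaf 54) (leaf 53)) (leaf 50)))
  (node 15 (leaf 47) (leaf 44))) (node 10 (leaf 45) (leaf 42))) (node 7 (node 10 (node 0 (leaf 53)
  (node 11 (leaf 53) (leaf 45))) (leaf 45)) (node 0 (node 10 (leaf 50) (leaf 49)) (node 11 (node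
  10 (leaf 49) (leaf 47)) (leaf 44)))))) (node 5 (node 7 (leaf 54) (node 16 (leaf 50) (leaf 49)))
  (node 16 (node 15 (node 14 (node 12 (node 7 (leaf 49) (leaf 47)) (leaf 47)) (leaf 44)) (node 12
  (leaf 44) (leaf 42))) (leaf 42)))) (node 7 (node 5 (node 0 (node 10 (leaf 64) (leaf 58)) (leaf
  58)) (node 9 (node 0 (node 10 (node 14 (node 15 (leaf 55) (leaf 53)) (node 11 (leaf 53) (leaf
  52))) (leaf 52)) (node 11 (node 10 (node 15 (node 14 (leaf 56) (leaf 52)) (leaf 52)) (node 14
  (node 15 (leaf 47) (leaf 46)) (leaf 43))) (node 15 (node 14 (leaf 51) (leaf 43)) (leaf 44))))
  (node 15 (node 14 (node 11 (node 12 (leaf 49) (leaf 45)) (leaf 47)) (leaf 44)) (leaf 44))))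
  (node 12 (node 9 (node 10 (node 17 (node 14 (node 15 (node 5 (node 11 (node 0 (leaf 54) (leaf
  53)) (node 0 (leaf 53) (leaf 44))) (node 0 (node 16 (leaf 53) (leaf 45)) (node 16 (node 11 (leaf
  52) (leaf 44)) (leaf 44)))) (node 0 (node 11 (leaf 49) (node 16 (leaf 46) (leaf 44))) (node 11
  (leaf 44) (leaf 38)))) (node 0 (node 16 (leaf 49) (node 11 (leaf 45) (leaf 44))) (node 16 (leaf
  46) (node 11 (leaf 44) (leaf 38))))) (node 5 (node 0 (leaf 50) (node 11 (leaf 49) (leaf 44)))
  (node 0 (node 11 (leaf 47) (node 14 (leaf 46) (leaf 42))) (node 11 (node 14 (leaf 44) (leaf 42))
  (leaf 36))))) (node 5 (leaf 45) (node 17 (node 14 (node 15 (node 16 (leaf 42) (leaf 38)) (leaf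
  38)) (node 16 (leaf 39) (leaf 38))) (node 11 (leaf 36) (leaf 35))))) (node 5 (leaf 44) (node 16
  (node 17 (node 15 (leaf 42) (leaf 38)) (leaf 36)) (leaf 38)))) (node 9 (node 10 (node 5 (leaf
  51) (node 17 (node 15 (node 16 (leaf 49) (leaf 43)) (leaf 44)) (leaf 44))) (node 5 (leaf 51)
  (node 17 (node 15 (node 16 (leaf 42) (leaf 38)) (leaf 38)) (leaf 36)))) (node 5 (leaf 51) (node
  17 (node 15 (node 16 (leaf 42) (leaf 38)) (leaf 38)) (leaf 36)))))))))))))

opaque
  unfolding wholeColumnFits

  -- The inequalities at all leaves are decided here by evaluation. How the values were found does
  -- not enter: any tree passing this check is a valid potential.
  potential-fits : leavesFit potential potential [] ≡ true
  potential-fits = refl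

-- The periodic pattern.

-- Width 17, 38 tetrominoes and one monomino; found as a cycle of profiles along
-- which the potential is lowered by exactly 17 g - 38 in total.
block : List Tetro
block =
  tetro stemDown 0 0 ∷ tetro stemRight 2 0 ∷ tetro stemUp 5 0 ∷ tetro stemUp 7 0 ∷
  tetro stemLeft 1 1 ∷ tetro stemDown 4 1 ∷ tetro stemLeft 6 2 ∷ tetro stemDown 0 3 ∷
  tetro stemRight 1 3 ∷ tetro stemUp 4 3 ∷ tetro stemLeft 2 4 ∷ tetro stemRight 6 4 ∷
  tetro stemUp 0 5 ∷ tetro stemUp 5 5 ∷ tetro stemUp 7 5 ∷ tetro stemRight 2 6 ∷
  tetro stemDown 0 7 ∷ tetro stemDown 2 7 ∷ tetro stemLeft 4 7 ∷ tetro stemDown 7 7 ∷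
  tetro stemLeft 0 9 ∷ tetro stemDown 3 9 ∷ tetro stemRight 4 9 ∷ tetro stemUp 7 9 ∷
  tetro stemLeft 5 10 ∷ tetro stemRight 0 11 ∷ tetro stemUp 3 11 ∷ tetro stemDown 0 12 ∷
  tetro stemDown 2 12 ∷ tetro stemRight 5 12 ∷ tetro stemUp 7 12 ∷ tetro stemLeft 4 13 ∷
  tetro stemLeft 0 14 ∷ tetro stemDown 3 14 ∷ tetro stemLeft 6 14 ∷ tetro stemUp 4 15 ∷
  tetro stemRight 0 16 ∷ tetro stemRight 6 16 ∷ []

-- The cells left free for the overhang of the block 17 columns to the left.
seam : List Cell
seam = (1 , 0) ∷ (5 , 0) ∷ (7 , 0) ∷ []

shiftCell : Cell → Cell
shiftCell (r , c) = r , 17 ℕ.+ c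

shiftCell-injective : ∀ {x y} → shiftCell x ≡ shiftCell y → x ≡ y
shiftCell-injective refl = refl

shiftTetro : Tetro → Tetro
shiftTetro (tetro o r c) = tetro o r (17 ℕ.+ c)

cells-shiftTetro : ∀ t → cells (shiftTetro t) ≡ map shiftCell (cells t)
cells-shiftTetro (tetro stemDown  r c) = refl
cells-shiftTetro (tetro stemUp    r c) = refl
cells-shiftTetro (tetro stemRight r c) = refl
cells-shiftTetro (tetro stemLeft  r c) = refl

blocks : ℕ → List Tetro
blocks zero    = []
blocks (suc q) = block ++ map shiftTetro (blocks q)

length-blocks : ∀ q → length (blocks q) ≡ q ℕ.* 38
length-blocks zero    = refl
length-blocks (suc q) = cong (38 ℕ.+_) (trans (length-map shiftTetro (blocks q)) (length-blocks q))

inRect? : ∀ m n → Decidable (InRect m n)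
inRect? m n (r , c) = (r ℕ.<? m) ×-dec (c ℕ.<? n)

insideRect? : ∀ m n → Decidable (λ t → All (InRect m n) (cells t))
insideRect? m n t = All.all? (inRect? m n) (cells t)

block-inside : All (λ t → All (InRect 9 18) (cells t)) block
block-inside = from-yes (All.all? (insideRect? 9 18) block)

block-unique : Unique (seam ++ concatMap cells block)
block-unique = from-yes (unique? (seam ++ concatMap cells block))

block-overhang : All (λ x → proj₂ x < 17 ⊎ x ∈ map shiftCell seam) (seam ++ concatMap cells block)
block-overhang = from-yes
  (All.all? (λ x → (proj₂ x ℕ.<? 17) ⊎-dec (x ∈? map shiftCell seam)) (seam ++ concatMap cells block))

-- The one column beyond `q * 17` holds the overhang of the last block.
blocks-inside : ∀ q → All (λ t → All (InRect 9 (suc (q ℕ.* 17))) (cells t)) (blocks q)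
blocks-inside zero    = []
blocks-inside (suc q) = All.++⁺
  (All.map (All.map (map₂ λ c<18 → ℕ.<-≤-trans c<18 (s≤s (ℕ.m≤m+n 17 (q ℕ.* 17))))) block-inside)
  (All.map⁺ (All.map shifted (blocks-inside q)))
  where
  shifted : ∀ {t} → All (InRect 9 (suc (q ℕ.* 17))) (cells t) →
    All (InRect 9 (suc (suc q ℕ.* 17))) (cells (shiftTetro t))
  shifted {t} is = subst (All _) (sym (cells-shiftTetro t))
    (All.map⁺ (All.map (λ {(r , c)} → map₂ λ c< →
      subst (17 ℕ.+ c <_) (ℕ.+-suc 17 (q ℕ.* 17)) (ℕ.+-monoʳ-< 17 c<)) is))

concatMap-cells-blocks : ∀ q →
  concatMap cells (blocks (suc q)) ≡ concatMap cells block ++ map shiftCell (concatMap cells (blocks q))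
concatMap-cells-blocks q = begin
  concatMap cells (block ++ map shiftTetro (blocks q))
    ≡⟨ concatMap-++ cells block (map shiftTetro (blocks q)) ⟩
  concatMap cells block ++ concatMap cells (map shiftTetro (blocks q))
    ≡⟨ cong (concatMap cells block ++_) (concatMap-map cells shiftTetro (blocks q)) ⟩
  concatMap cells block ++ concatMap (cells ∘′ shiftTetro) (blocks q)
    ≡⟨ cong (concatMap cells block ++_) (concatMap-cong cells-shiftTetro (blocks q)) ⟩
  concatMap cells block ++ concatMap (map shiftCell ∘′ cells) (blocks q)
    ≡⟨ cong (concatMap cells block ++_) (map-concatMap shiftCell cells (blocks q)) ⟨
  concatMap cells block ++ map shiftCell (concatMap cells (blocks q)) ∎
  where open ≡-Reasoning

-- A cell in the first 17 columns is no shifted cell at all, and an overhanging one lies in the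
-- shifted seam, which the later blocks leave free. Thus the finite check of a single block suffices
-- for any number of them.
shifted-disjoint : ∀ {seam xs ys} → All (λ x → proj₂ x < 17 ⊎ x ∈ map shiftCell seam) xs →
  Disjoint seam ys → Disjoint xs (map shiftCell ys)
shifted-disjoint overhang seam#ys (x∈ , x∈′) with ∈-map⁻ shiftCell x∈′ | All.lookup overhang x∈
... | y , y∈ , refl | inj₁ c<17 = ℕ.m+n≮m 17 (proj₂ y) c<17
... | y , y∈ , refl | inj₂ x∈seam with ∈-map⁻ shiftCell x∈seam
...   | z , z∈ , eq with shiftCell-injective {y} {z} eq
...     | refl = seam#ys (z∈ , y∈)

-- Including the seam strengthens the induction: the hypothesis then says that the later blocks keep
-- clear of their own seam, as the overhang of the block before them requires.
blocks-unique : ∀ q → Unique (seam ++ concatMap cells (blocks q))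
blocks-unique zero    = from-yes (unique? (seam ++ []))
blocks-unique (suc q) = subst Unique
  (trans (++-assoc seam (concatMap cells block) _) (cong (seam ++_) (sym (concatMap-cells-blocks q))))
  (Unique.++⁺ block-unique (Unique.map⁺ shiftCell-injective (Unique-++⁻ʳ seam (blocks-unique q)))
    (shifted-disjoint block-overhang (Unique-++⁻-Disjoint seam (blocks-unique q))))

blocks-tiling : ∀ {n} q → q ℕ.* 17 < n → IsTTiling 9 n (blocks q)
blocks-tiling q q17<n =
  All.map (All.map (map₂ λ c< → ℕ.<-≤-trans c< q17<n)) (blocks-inside q) , Unique-++⁻ʳ seam (blocks-unique q)

-- Minimal tilings by finite search.

isTTiling? : ∀ m n → Decidable (IsTTiling m n)
isTTiling? m n ts = All.all? (insideRect? m n) ts ×-dec unique? (concatMap cells ts)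

listsUpTo : ∀ {A : Set} → ℕ → List A → List (List A)
listsUpTo zero    xs = [] ∷ []
listsUpTo (suc l) xs = [] ∷ cartesianProductWith _∷_ xs (listsUpTo l xs)

∈-listsUpTo : ∀ {A : Set} {xs : List A} l ts → All (_∈ xs) ts → length ts ≤ l → ts ∈ listsUpTo l xs
∈-listsUpTo zero    []       _          _         = here refl
∈-listsUpTo (suc l) []       _          _         = here refl
∈-listsUpTo (suc l) (t ∷ ts) (t∈ ∷ ts∈) (s≤s len) =
  there (∈-cartesianProductWith⁺ _∷_ t∈ (∈-listsUpTo l ts ts∈ len))

orientations : List Orientation
orientations = stemDown ∷ stemUp ∷ stemRight ∷ stemLeft ∷ []

∈-orientations : ∀ o → o ∈ orientations
∈-orientations stemDown  = here refl
∈-orientations stemUp    = there (here refl)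
∈-orientations stemRight = there (there (here refl))
∈-orientations stemLeft  = there (there (there (here refl)))

-- The corners run through all cells of the rectangle, so some of these tetrominoes stick out;
-- filtering by `isTTiling?` later discards the lists that contain them.
tetros : ℕ → ℕ → List Tetro
tetros m n = cartesianProductWith (λ o (r , c) → tetro o r c) orientations (cartesianProduct (upTo m) (upTo n))

∈-tetros : ∀ {m n} t → All (InRect m n) (cells t) → t ∈ tetros m n
∈-tetros (tetro o r c) inside = ∈-cartesianProductWith⁺ (λ o (r , c) → tetro o r c) (∈-orientations o)
  (∈-cartesianProduct⁺ (∈-upTo⁺ (row< o inside)) (∈-upTo⁺ (col< o inside)))
  where
  -- For `stemUp` and `stemLeft` the corner of the bounding box is not a cell of the tetromino, so
  -- its row and its column are read off different cells.
  row< : ∀ {m n r c} o → All (InRect m n) (cells (tetro o r c)) → r < m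
  row< stemDown  ((r<m , _) ∷ _)             = r<m
  row< stemUp    (_ ∷ _ ∷ _ ∷ (r<m , _) ∷ _) = r<m
  row< stemRight ((r<m , _) ∷ _)             = r<m
  row< stemLeft  ((r<m , _) ∷ _)             = r<m
  col< : ∀ {m n r c} o → All (InRect m n) (cells (tetro o r c)) → c < n
  col< stemDown  ((_ , c<n) ∷ _)             = c<n
  col< stemUp    ((_ , c<n) ∷ _)             = c<n
  col< stemRight ((_ , c<n) ∷ _)             = c<n
  col< stemLeft  (_ ∷ _ ∷ _ ∷ (_ , c<n) ∷ _) = c<n

-- The boundary term of the telescoped inequality, for a scan that starts with no cell covered. It
-- evaluates to 94, the leftmost leaf of `potential`.
slack : ℕ
slack = value potential []

tetro-bound : ∀ n ts → IsTTiling 9 n ts → 17 ℕ.* length ts ≤ 38 ℕ.* n ℕ.+ slack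
tetro-bound n ts tiling =
  potential-bound potential potential-fits n n 0 [] ts refl (IsTTiling⇒Config n ts tiling)

-- Any a priori bound on the number of tetrominoes makes the search finite; the one used comes from
-- `tetro-bound` with the factor 17 dropped.
candidates : ℕ → List (List Tetro)
candidates n = listsUpTo (38 ℕ.* n ℕ.+ slack) (tetros 9 n)

-- The seed `[]` of the minimum is itself a tiling, the one by monominoes alone, so the result is a
-- tiling in every case.
best : ℕ → List Tetro
best n = argmin (monominos 9 n) [] (filter (isTTiling? 9 n) (candidates n))

best-tiling : ∀ n → IsTTiling 9 n (best n)
best-tiling n = argmin-all (monominos 9 n) ([] , []) (All.all-filter (isTTiling? 9 n) (candidates n))

best-minimal : ∀ n ts → IsTTiling 9 n ts → monominos 9 n (best n) ≤ monominos 9 n ts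
best-minimal n ts tiling = All.lookup
  (f[argmin]≤f[xs] {f = monominos 9 n} [] (filter (isTTiling? 9 n) (candidates n)))
  (∈-filter⁺ (isTTiling? 9 n)
    (∈-listsUpTo (38 ℕ.* n ℕ.+ slack) ts (All.map (λ {t} → ∈-tetros t) (proj₁ tiling))
      (ℕ.≤-trans (ℕ.m≤n*m (length ts) 17) (tetro-bound n ts tiling)))
    tiling)

-- The two bounds on the least number of monominoes.

-- Multiplying the cell count by 17 gives 153 columns' worth of `n`, of which the tetrominoes
-- account for 4 * 38 = 152 up to a constant; the remaining single `n` must be matched by 17
-- monominoes per 17 columns' share, that is, by `17 * k`.
gap-lower : ∀ n → n / 17 ≤ monominos 9 n (best n) ℕ.+ slack
gap-lower n = ℕ.*-cancelˡ-≤ 17 (begin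
  17 ℕ.* (n / 17)                        ≡⟨ ℕ.*-comm 17 (n / 17) ⟩
  n / 17 ℕ.* 17                          ≤⟨ m/n*n≤m n 17 ⟩
  n                                      ≤⟨ ℕ.+-cancelʳ-≤ (152 ℕ.* n) _ _ scaled ⟩
  -- The coefficient 4 is raised to 17 so that the common factor can be cancelled.
  17 ℕ.* k ℕ.+ 4 ℕ.* slack               ≤⟨ ℕ.+-monoʳ-≤ (17 ℕ.* k) (ℕ.*-monoˡ-≤ slack (ℕ.m≤m+n 4 13)) ⟩
  17 ℕ.* k ℕ.+ 17 ℕ.* slack              ≡⟨ ℕ.*-distribˡ-+ 17 k slack ⟨
  17 ℕ.* (k ℕ.+ slack)                   ∎)
  where
  open ℕ.≤-Reasoning
  k = monominos 9 n (best n)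
  l = length (best n)
  regroup : ∀ l k → 17 ℕ.* (4 ℕ.* l ℕ.+ k) ≡ 17 ℕ.* k ℕ.+ 4 ℕ.* (17 ℕ.* l)
  regroup = solve-∀
  regroup′ : ∀ x n v → x ℕ.+ 4 ℕ.* (38 ℕ.* n ℕ.+ v) ≡ x ℕ.+ 4 ℕ.* v ℕ.+ 152 ℕ.* n
  regroup′ = solve-∀
  scaled : n ℕ.+ 152 ℕ.* n ≤ 17 ℕ.* k ℕ.+ 4 ℕ.* slack ℕ.+ 152 ℕ.* n
  scaled = begin
    -- `17 * 9` computes to 153, and `153 * n` unfolds to `n + 152 * n`.
    n ℕ.+ 152 ℕ.* n                           ≡⟨ ℕ.*-assoc 17 9 n ⟩
    17 ℕ.* (9 ℕ.* n)                          ≤⟨ ℕ.*-monoʳ-≤ 17 (ℕ.m≤n+m∸n (9 ℕ.* n) (4 ℕ.* l)) ⟩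
    17 ℕ.* (4 ℕ.* l ℕ.+ k)                    ≡⟨ regroup l k ⟩
    17 ℕ.* k ℕ.+ 4 ℕ.* (17 ℕ.* l)             ≤⟨ ℕ.+-monoʳ-≤ (17 ℕ.* k)
                                                   (ℕ.*-monoʳ-≤ 4 (tetro-bound n (best n) (best-tiling n))) ⟩
    17 ℕ.* k ℕ.+ 4 ℕ.* (38 ℕ.* n ℕ.+ slack)   ≡⟨ regroup′ (17 ℕ.* k) n slack ⟩
    17 ℕ.* k ℕ.+ 4 ℕ.* slack ℕ.+ 152 ℕ.* n    ∎

-- One block fewer than would fit by width alone, so that the overhang of the
-- last one stays inside the rectangle.
gap-upper : ∀ n → n > 0 → monominos 9 n (best n) ≤ n / 17 ℕ.+ 296
gap-upper n n>0 = ℕ.≤-trans (best-minimal n (blocks p) (blocks-tiling p fitting)) (begin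
  9 ℕ.* n ∸ 4 ℕ.* length (blocks p)                       ≡⟨ cong (λ l → 9 ℕ.* n ∸ 4 ℕ.* l) (length-blocks p) ⟩
  9 ℕ.* n ∸ 4 ℕ.* (p ℕ.* 38)                              ≤⟨ ℕ.∸-monoˡ-≤ (4 ℕ.* (p ℕ.* 38)) bound ⟩
  q ℕ.+ 296 ℕ.+ 4 ℕ.* (p ℕ.* 38) ∸ 4 ℕ.* (p ℕ.* 38)       ≡⟨ ℕ.m+n∸n≡m (q ℕ.+ 296) (4 ℕ.* (p ℕ.* 38)) ⟩
  q ℕ.+ 296                                               ∎)
  where
  open ℕ.≤-Reasoning
  q = n / 17
  p = pred q
  fitting : p ℕ.* 17 < n
  -- With no full block, `pred` returns 0 and the empty pattern needs just `n > 0`. Otherwise the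
  -- omitted block leaves 17 spare columns.
  fitting with n / 17 | m/n*n≤m n 17
  ... | zero  | _    = n>0
  ... | suc q | q17≤ = ℕ.<-≤-trans (ℕ.m<n+m (q ℕ.* 17) (s≤s z≤n)) q17≤
  -- The constant 296 is 144 + 152: at most 16 leftover columns contribute 9 * 16 cells, and the
  -- omitted block would have covered 4 * 38 more. The separate `q` counts one monomino per 17
  -- columns.
  expand : ∀ q → 9 ℕ.* (16 ℕ.+ q ℕ.* 17) ≡ q ℕ.+ 144 ℕ.+ 152 ℕ.* q
  expand = solve-∀
  collect : ∀ q p → q ℕ.+ 144 ℕ.+ 152 ℕ.* suc p ≡ q ℕ.+ 296 ℕ.+ 4 ℕ.* (p ℕ.* 38)
  collect = solve-∀
  bound : 9 ℕ.* n ≤ q ℕ.+ 296 ℕ.+ 4 ℕ.* (p ℕ.* 38)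
  bound = begin
    9 ℕ.* n                               ≡⟨ cong (9 ℕ.*_) (m≡m%n+[m/n]*n n 17) ⟩
    9 ℕ.* (n % 17 ℕ.+ q ℕ.* 17)           ≤⟨ ℕ.*-monoʳ-≤ 9 (ℕ.+-monoˡ-≤ (q ℕ.* 17) (ℕ.s≤s⁻¹ (m%n<n n 17))) ⟩
    9 ℕ.* (16 ℕ.+ q ℕ.* 17)               ≡⟨ expand q ⟩
    q ℕ.+ 144 ℕ.+ 152 ℕ.* q               ≤⟨ ℕ.+-monoʳ-≤ (q ℕ.+ 144) (ℕ.*-monoʳ-≤ 152 (ℕ.m≤n+m∸n q 1)) ⟩
    q ℕ.+ 144 ℕ.+ 152 ℕ.* suc p           ≡⟨ collect q p ⟩
    q ℕ.+ 296 ℕ.+ 4 ℕ.* (p ℕ.* 38)        ∎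

-- The error term.

∣⊖∣≤ : ∀ {m n b} → m ≤ n ℕ.+ b → n ≤ m ℕ.+ b → ∣ m ⊖ n ∣ ≤ b
∣⊖∣≤ {m} {n} {b} m≤ n≤ with ℕ.≤-total m n
... | inj₁ m≤n = subst (_≤ b) (sym (ℤ.∣⊖∣-≤ m≤n)) (ℕ.m≤n+o⇒m∸n≤o n m n≤)
... | inj₂ n≤m = subst (_≤ b) (sym (trans (ℤ.∣m⊖n∣≡∣n⊖m∣ m n) (ℤ.∣⊖∣-≤ n≤m))) (ℕ.m≤n+o⇒m∸n≤o m n m≤)

gap-number : ∀ n k → IsGapNumber 9 n k → k ≡ monominos 9 n (best n)
gap-number n k ((ts , tiling , refl) , minimal) =
  ℕ.≤-antisym (minimal _ (best n , best-tiling n , refl)) (best-minimal n ts tiling)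

theorem2 : Σ (ℕ → ℤ) λ e₉ → Σ ℕ λ B → (∀ n → n > 0 → ∣ e₉ n ∣ ≤ B) × (∀ n → n > 0 → ∀ k → IsGapNumber 9 n k → + k ≡ + (n / 17) + e₉ n)
-- The sum serves both sides at once: 296 limits the excess over `n / 17`, and `slack` the deficit.
theorem2 = (λ n → monominos 9 n (best n) ⊖ n / 17) , 296 ℕ.+ slack , bounded , equation
  where
  bounded : ∀ n → n > 0 → ∣ monominos 9 n (best n) ⊖ n / 17 ∣ ≤ 296 ℕ.+ slack
  bounded n n>0 = ∣⊖∣≤
    (ℕ.≤-trans (gap-upper n n>0) (ℕ.+-monoʳ-≤ (n / 17) (ℕ.m≤m+n 296 slack)))
    (ℕ.≤-trans (gap-lower n) (ℕ.+-monoʳ-≤ (monominos 9 n (best n)) (ℕ.m≤n+m slack 296)))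
  equation : ∀ n → n > 0 → ∀ k → IsGapNumber 9 n k → + k ≡ + (n / 17) + (monominos 9 n (best n) ⊖ n / 17)
  equation n _ k gap = begin
    -- Adding and removing `n / 17` turns `k` into an integer difference, from which `n / 17` can be
    -- split off; truncation does no harm, as the minuend contains the subtrahend.
    + k                                             ≡⟨ cong (+_) (ℕ.m+n∸m≡n (n / 17) k) ⟨
    + (n / 17 ℕ.+ k ∸ n / 17)                       ≡⟨ ℤ.⊖-≥ (ℕ.m≤m+n (n / 17) k) ⟨
    n / 17 ℕ.+ k ⊖ n / 17                           ≡⟨ ℤ.distribʳ-⊖-+-pos (n / 17) k (n / 17) ⟨
    + (n / 17) + (k ⊖ n / 17)                       ≡⟨ cong (λ k → + (n / 17) + (k ⊖ n / 17)) (gap-number n k gap) ⟩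
    + (n / 17) + (monominos 9 n (best n) ⊖ n / 17)  ∎
    where open ≡-Reasoning
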